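{- Let $\mathfrak g=\mathfrak{gl}_{n+1}(\mathbb C)$ with trace pairing $\langle a,b\rangle=\mathrm{tr}(ab)$. For $\tau\in\mathfrak g$ let $\tau_H\in\mathfrak g$ be obtained by replacing the last row and last column of $\tau$ by zeros, let $1_H=\mathrm{diag}(1,\dots,1,0)$, and set $\tau_H^j:=1_H(\tau_H)^j$ for $j\ge0$ (so $\tau_H^0=1_H$). Let $D(\tau)$ be the $n\times n$ matrix with entries $D(\tau)_{ij}=\langle[1_H,[\tau^i,\tau_H^{j-1}]],\tau\rangle$ ($1\le i,j\le n$) and $\Delta(\tau)=\det D(\tau)$. Let $\lambda_1,\dots,\lambda_{n+1}$ be the eigenvalues of $\tau$ and $\mu_1,\dots,\mu_n$ those of the upper-left $n\times n$ block of $\tau$ (with multiplicity), and $\Delta_0(\tau)=\prod_{i=1}^{n+1}\prod_{j=1}^n(\lambda_i-\mu_j)$. Then for all $\tau\in\mathfrak g$, \[\Delta(\tau)=2^n(-1)^{n(n-1)/2}\Delta_0(\tau).\] -}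

module Defs where

open import Level using (Level; _⊔_)
open import Algebra.Bundles using (CommutativeRing)
open import Data.Nat as ℕ using (ℕ; zero; suc)
open import Data.Nat.DivMod using (_/_)
open import Data.Fin as Fin using (Fin; zero; suc; toℕ; inject₁; fromℕ)
open import Data.Fin.Properties using (_≟_)
open import Data.Product using (Σ; _×_)
open import Relation.Nullary using (¬_; yes; no)
open import Relation.Binary.PropositionalEquality using (_≡_)

-- An algebraically closed field of characteristic 0 (a stand-in for ℂ:
-- the first-order theory ACF₀ is complete, so a polynomial identity
-- holding in every such field is the same as holding in ℂ).
module RingOps {c ℓ} (R : CommutativeRing c ℓ) where
  open CommutativeRing R using (Carrier; _+_; _*_; 0#; 1#)

  ⟦_⟧ : ℕ → Carrier
  ⟦ zero ⟧  = 0#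
  ⟦ suc k ⟧ = 1# + ⟦ k ⟧

  _^_ : Carrier → ℕ → Carrier
  x ^ zero  = 1#
  x ^ suc k = x * (x ^ k)

  Σ[_] : ∀ {k} → (Fin k → Carrier) → Carrier
  Σ[_] {zero}  f = 0#
  Σ[_] {suc k} f = f zero + Σ[ (λ i → f (suc i)) ]

  Π[_] : ∀ {k} → (Fin k → Carrier) → Carrier
  Π[_] {zero}  f = 1#
  Π[_] {suc k} f = f zero * Π[ (λ i → f (suc i)) ]

record ACF₀ (c ℓ : Level) : Set (Level.suc (c ⊔ ℓ)) where
  field
    ring : CommutativeRing c ℓ
  open CommutativeRing ring public using (Carrier; _≈_; _+_; _*_; -_; _-_; 0#; 1#)
  open RingOps ring public
  field
    1≉0          : ¬ (1# ≈ 0#)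
    inverse      : ∀ x → ¬ (x ≈ 0#) → Σ Carrier (λ y → x * y ≈ 1#)
    char-zero    : ∀ k → ⟦ k ⟧ ≈ 0# → k ≡ zero
    alg-closed   : ∀ d (cs : Fin (suc d) → Carrier) →
                   Σ Carrier (λ x → (x ^ suc d) + Σ[ (λ i → cs i * (x ^ toℕ i)) ] ≈ 0#)

module Matrices {c ℓ} (K : ACF₀ c ℓ) where
  open ACF₀ K

  Mat : ℕ → Set c
  Mat m = Fin m → Fin m → Carrier

  _·_ : ∀ {m} → Mat m → Mat m → Mat m
  (A · B) i j = Σ[ (λ k → A i k * B k j) ]

  _⊖_ : ∀ {m} → Mat m → Mat m → Mat m
  (A ⊖ B) i j = A i j - B i j

  I : ∀ {m} → Mat m
  I i j with i ≟ j
  ... | yes _ = 1#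
  ... | no  _ = 0#

  _^ᴹ_ : ∀ {m} → Mat m → ℕ → Mat m
  A ^ᴹ zero  = I
  A ^ᴹ suc k = A · (A ^ᴹ k)

  [_,_] : ∀ {m} → Mat m → Mat m → Mat m
  [ A , B ] = (A · B) ⊖ (B · A)

  tr : ∀ {m} → Mat m → Carrier
  tr A = Σ[ (λ i → A i i) ]

  ⟨_,_⟩ : ∀ {m} → Mat m → Mat m → Carrier
  ⟨ A , B ⟩ = tr (A · B)

  minor : ∀ {m} → Mat (suc m) → Fin (suc m) → Mat m
  minor A j r s = A (suc r) (Fin.punchIn j s)

  sgn : ℕ → Carrier
  sgn zero    = 1#
  sgn (suc k) = - sgn k

  det : ∀ {m} → Mat m → Carrier
  det {zero}  A = 1#
  det {suc m} A = Σ[ (λ j → sgn (toℕ j) * (A zero j * det (minor A j))) ]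

  scal : ∀ {m} → Carrier → Mat m
  scal x i j with i ≟ j
  ... | yes _ = x
  ... | no  _ = 0#

  -- λ : Fin m → K lists the eigenvalues of A with multiplicity:
  -- the characteristic polynomial det(xI - A) equals ∏ (x - λ_i)
  -- (as polynomial functions; K is infinite, so this is equality of polynomials)
  IsEigenvalueList : ∀ {m} → Mat m → (Fin m → Carrier) → Set (c ⊔ ℓ)
  IsEigenvalueList A λs = ∀ x → det (scal x ⊖ A) ≈ Π[ (λ i → x - λs i) ]

  module _ {n : ℕ} where
    isLast : Fin (suc n) → Set
    isLast i = toℕ i ≡ n

    1H : Mat (suc n)
    1H i j with i ≟ j | toℕ i ℕ.≟ n
    ... | yes _ | no _ = 1#
    ... | _     | _    = 0#

    _H : Mat (suc n) → Mat (suc n)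
    (τ H) i j with toℕ i ℕ.≟ n | toℕ j ℕ.≟ n
    ... | no _ | no _ = τ i j
    ... | _    | _    = 0#

    Hpow : Mat (suc n) → ℕ → Mat (suc n)
    Hpow τ j = 1H · ((τ H) ^ᴹ j)

    block : Mat (suc n) → Mat n
    block τ i j = τ (inject₁ i) (inject₁ j)

    -- D(τ)_{ij} = ⟨[1_H,[τ^i, τ_H^{j-1}]], τ⟩ for 1 ≤ i,j ≤ n
    -- (Fin n index i stands for i+1, index j stands for j+1, so j-1 = toℕ j)
    Dmat : Mat (suc n) → Mat n
    Dmat τ i j = ⟨ [ 1H , [ τ ^ᴹ suc (toℕ i) , Hpow τ (toℕ j) ] ] , τ ⟩

    Δ : Mat (suc n) → Carrier
    Δ τ = det (Dmat τ)

    Δ₀ : (Fin (suc n) → Carrier) → (Fin n → Carrier) → Carrier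
    Δ₀ λs μs = Π[ (λ i → Π[ (λ j → λs i - μs j) ]) ]

    const : Carrier
    const = (⟦ 2 ⟧ ^ n) * sgn ((n ℕ.* (n ℕ.∸ 1)) / 2)

{-# OPTIONS --safe #-}
module Submission where

-- Write τ in blocks as A, col, row, d. A direct computation gives D(τ)ᵢⱼ = -2 Rᵢ · Aʲ col, where
-- R₀ = row and Rᵢ₊₁ = Rᵢ A + pᵢ row for scalars pᵢ. Unitriangular row and column operations replace
-- Rᵢ by row ∏_{k<i} (A - μₖ) and Aʲ col by ∏_{k≥n-j} (A - μₖ) col. By Cayley-Hamilton the matrix of
-- pairings of these vectors is antitriangular, with antidiagonal entries
-- gᵢ = row ∏_{k≠i} (A - μₖ) col. On the other hand ∏_{k≠i} (A - μₖ) is the adjugate of μᵢ - A, so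
-- the bordered determinant det (x - τ) takes the value -gᵢ at x = μᵢ. Hence ∏ᵢⱼ (λᵢ - μⱼ) is, up to
-- sign, the product of the gᵢ.

open import Defs
open import Algebra.Bundles using (CommutativeRing; RawRing)
open import Algebra.Solver.Ring.AlmostCommutativeRing using (_-Raw-AlmostCommutative⟶_; fromCommutativeRing)
open import Data.Fin as Fin using (Fin; zero; suc; toℕ; inject₁; fromℕ; punchIn; punchOut; fromℕ<)
import Data.Fin.Properties as Finₚ
open import Data.Fin.Relation.Unary.Top using (view; ‵fromℕ; ‵inject₁)
open import Data.Maybe using (Maybe; just; nothing)
open import Data.Nat as ℕ using (ℕ; zero; suc)
open import Data.Nat.DivMod using (_/_; m*n/n≡m; +-distrib-/-∣ˡ)
open import Data.Nat.Divisibility using (n∣m*n)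
import Data.Nat.Properties as ℕₚ
open import Data.Nat.Solver using () renaming (module +-*-Solver to ℕSolver)
open import Data.Product using (Σ; _,_; proj₁; proj₂) renaming (_×_ to _×ₜ_)
open import Data.Sum using (_⊎_; inj₁; inj₂)
open import Function using (_∘_)
open import Level using (_⊔_)
open import Relation.Binary.Definitions using (tri<; tri≈; tri>)
open import Relation.Binary.PropositionalEquality as ≡ using (_≡_; _≢_; cong; cong₂; subst)
open import Relation.Nullary using (¬_; Dec; yes; no; contradiction)

-- Eigenvalues may coincide, and no density argument is made. Therefore ∏_{k≠i} (A - μₖ) is obtained
-- as the value at μᵢ of the quotient (f(x) - f(A)) / (x - A), with f the characteristic polynomial
-- of A; this makes sense for repeated roots too. Cayley-Hamilton and the adjugate formula both come
-- out of one uniqueness statement. The cofactors of the last column of x - τ and the quotient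
-- applied to `row` are polynomial in x and solve C(x) (x - A) = f(x) row, the latter up to the
-- constant row f(A). Comparing degrees forces the two solutions to agree and the constant to
-- vanish. Polynomials are functions here, so degree is measured by iterated divided differences,
-- and characteristic 0 supplies the distinct points ⟦m⟧ at which to compare. The 2 in each entry of
-- D arises because the last row and the last column of a power of τ contribute equally. As for
-- signs, the antidiagonal gives (-1)^(n(n-1)/2). For each μⱼ, replacing λᵢ - μⱼ by μⱼ - λᵢ and then
-- by -gⱼ costs (-1)^n, hence (-1)^(n²) = (-1)^n over all j, which absorbs the sign of (-2)^n.

module _ {c ℓ} (K : ACF₀ c ℓ) where
  open ACF₀ K
  open Matrices K
  open CommutativeRing ring
    using ( refl; sym; trans; reflexive; setoid; +-cong; +-congˡ; +-congʳ; *-cong; *-congˡ; *-congʳ; -‿cong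
          ; +-identityˡ; +-identityʳ; *-identityˡ; *-identityʳ; zeroˡ; zeroʳ; distribˡ; distribʳ; -‿inverseʳ; +-assoc; +-comm; *-comm; *-assoc
          ; semiring; *-commutativeMonoid; +-commutativeSemigroup; +-abelianGroup )
  open import Algebra.Properties.Ring (CommutativeRing.ring ring)
    using (-‿distribˡ-*; -‿distribʳ-*; -‿involutive)
  open import Relation.Binary.Reasoning.Setoid setoid
  open import Algebra.Properties.Semiring.Mult semiring using (_×_; ×-homo-+; ×1-homo-*)
  open import Algebra.Properties.AbelianGroup +-abelianGroup using (⁻¹-∙-comm; ε⁻¹≈ε; x∙y⁻¹≈ε⇒x≈y)
  open import Algebra.Properties.CommutativeSemigroup +-commutativeSemigroup using (interchange)

  -- A ring solver with integer coefficients

  -- Formal differences of naturals serve as coefficients of the ring solver,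
  -- so that it can cancel x against - x.
  evalDiff : ℕ ×ₜ ℕ → Carrier
  evalDiff (0 , 0) = 0#
  evalDiff (1 , 0) = 1#
  evalDiff (a , b) = a × 1# - b × 1#

  -- The special clauses of `evalDiff` make the coefficients 0 and 1 evaluate to `0#` and `1#`
  -- definitionally, so that solver equations match goals in which these constants occur literally.
  -- This lemma recovers the uniform formula.
  evalDiff≈ : ∀ p → evalDiff p ≈ proj₁ p × 1# - proj₂ p × 1#
  evalDiff≈ (0 , 0) = sym (-‿inverseʳ 0#)
  evalDiff≈ (1 , 0) = sym (trans (+-cong (+-identityʳ 1#) ε⁻¹≈ε) (+-identityʳ 1#))
  evalDiff≈ (0 , suc b) = refl
  evalDiff≈ (1 , suc b) = refl
  evalDiff≈ (suc (suc a) , b) = refl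

  -- Cancelling the common part leaves one pair per integer, so the componentwise comparison in
  -- `evalDiff-≟` recognises equal coefficients.
  normalise : ℕ ×ₜ ℕ → ℕ ×ₜ ℕ
  normalise (suc a , suc b) = normalise (a , b)
  normalise (a , b)         = a , b

  evalDiff-normalise : ∀ p → evalDiff (normalise p) ≈ proj₁ p × 1# - proj₂ p × 1#
  evalDiff-normalise (zero , b)     = evalDiff≈ (zero , b)
  evalDiff-normalise (suc a , zero) = evalDiff≈ (suc a , zero)
  evalDiff-normalise (suc a , suc b) = begin
    evalDiff (normalise (a , b))          ≈⟨ evalDiff-normalise (a , b) ⟩
    a × 1# - b × 1#                       ≈⟨ +-identityˡ _ ⟨
    0# + (a × 1# - b × 1#)                ≈⟨ +-congʳ (-‿inverseʳ 1#) ⟨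
    1# - 1# + (a × 1# - b × 1#)           ≈⟨ interchange _ _ _ _ ⟩
    1# + a × 1# + (- 1# - b × 1#)         ≈⟨ +-congˡ (⁻¹-∙-comm _ _) ⟩
    1# + a × 1# - (1# + b × 1#)           ∎

  diffRing : RawRing _ _
  diffRing = record
    { Carrier = ℕ ×ₜ ℕ
    ; _≈_ = _≡_
    ; _+_ = λ (a , b) (a' , b') → normalise (a ℕ.+ a' , b ℕ.+ b')
    ; _*_ = λ (a , b) (a' , b') → normalise (a ℕ.* a' ℕ.+ b ℕ.* b' , a ℕ.* b' ℕ.+ b ℕ.* a')
    ; -_ = λ (a , b) → b , a
    ; 0# = 0 , 0
    ; 1# = 1 , 0
    }

  private
    expand : ∀ w x y z → w * y + x * z + (w * z + x * y) ≈ (w + x) * (y + z)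
    expand w x y z = begin
      w * y + x * z + (w * z + x * y)    ≈⟨ +-congˡ (+-comm _ _) ⟩
      w * y + x * z + (x * y + w * z)    ≈⟨ interchange _ _ _ _ ⟩
      w * y + x * y + (x * z + w * z)    ≈⟨ +-congˡ (+-comm _ _) ⟩
      w * y + x * y + (w * z + x * z)    ≈⟨ +-cong (distribʳ y w x) (distribʳ z w x) ⟨
      (w + x) * y + (w + x) * z          ≈⟨ distribˡ (w + x) y z ⟨
      (w + x) * (y + z)                  ∎

  evalDiff-morphism : diffRing -Raw-AlmostCommutative⟶ fromCommutativeRing ring
  evalDiff-morphism = record
    { ⟦_⟧ = evalDiff
    ; +-homo = λ p q → begin
        evalDiff (RawRing._+_ diffRing p q)                         ≈⟨ evalDiff-normalise (proj₁ p ℕ.+ proj₁ q , proj₂ p ℕ.+ proj₂ q) ⟩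
        _ - _                                                       ≈⟨ +-cong (×-homo-+ 1# (proj₁ p) _) (-‿cong (×-homo-+ 1# (proj₂ p) _)) ⟩
        _ - (_ + _)                                                 ≈⟨ +-congˡ (⁻¹-∙-comm _ _) ⟨
        _ + _ + (- _ - _)                                           ≈⟨ interchange _ _ _ _ ⟩
        _ - _ + (_ - _)                                             ≈⟨ +-cong (evalDiff≈ p) (evalDiff≈ q) ⟨
        evalDiff p + evalDiff q ∎
    ; *-homo = λ p@(a , b) q@(a' , b') → let A = a × 1#; A' = a' × 1#; B = b × 1#; B' = b' × 1# in begin
        evalDiff (RawRing._*_ diffRing p q)                         ≈⟨ evalDiff-normalise (a ℕ.* a' ℕ.+ b ℕ.* b' , a ℕ.* b' ℕ.+ b ℕ.* a') ⟩
        _ - _                                                       ≈⟨ +-cong (×-homo-+ 1# (a ℕ.* a') _) (-‿cong (×-homo-+ 1# (a ℕ.* b') _)) ⟩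
        _ + _ - (_ + _)                                             ≈⟨ +-cong (+-cong (×1-homo-* a a') (×1-homo-* b b')) (-‿cong (+-cong (×1-homo-* a b') (×1-homo-* b a'))) ⟩
        A * A' + B * B' - (A * B' + B * A')                         ≈⟨ +-cong (+-congˡ (trans (sym (-‿involutive _)) (trans (-‿cong (-‿distribˡ-* B B')) (-‿distribʳ-* (- B) B')))) (trans (sym (⁻¹-∙-comm _ _)) (+-cong (-‿distribʳ-* A B') (-‿distribˡ-* B A'))) ⟩
        A * A' + (- B) * (- B') + (A * (- B') + (- B) * A')         ≈⟨ expand A (- B) A' (- B') ⟩
        (A - B) * (A' - B')                                         ≈⟨ *-cong (evalDiff≈ p) (evalDiff≈ q) ⟨
        evalDiff p * evalDiff q ∎
    ; -‿homo = λ p → begin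
        evalDiff (RawRing.-_ diffRing p)  ≈⟨ evalDiff≈ (RawRing.-_ diffRing p) ⟩
        _ - _                             ≈⟨ +-comm _ _ ⟩
        - _ + _                           ≈⟨ +-congˡ (-‿involutive _) ⟨
        - _ + - - _                       ≈⟨ ⁻¹-∙-comm _ _ ⟩
        - (_ - _)                         ≈⟨ -‿cong (evalDiff≈ p) ⟨
        - evalDiff p ∎
    ; 0-homo = refl
    ; 1-homo = refl
    }

  evalDiff-≟ : ∀ p q → Maybe (evalDiff p ≈ evalDiff q)
  evalDiff-≟ (a , b) (a' , b') with a ℕ.≟ a' | b ℕ.≟ b'
  ... | yes e | yes e' = just (reflexive (cong₂ (λ x y → evalDiff (x , y)) e e'))
  ... | _     | _      = nothing

  open import Algebra.Solver.Ring diffRing (fromCommutativeRing ring) evalDiff-morphism evalDiff-≟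
    using (solve; _:=_; _:+_; _:*_; _:-_; :-_; con)

  -- Finite sums and products

  open import Algebra.Properties.Semiring.Sum semiring using (sum; ∑-distrib-+; ∑-comm; *-distribˡ-sum)
  open import Algebra.Properties.CommutativeMonoid.Sum *-commutativeMonoid
    renaming (sum to product; ∑-distrib-+ to ∏-distrib-*; ∑-comm to ∏-comm) using ()

  Σ-cong : ∀ {k} {f g : Fin k → Carrier} → (∀ i → f i ≈ g i) → Σ[ f ] ≈ Σ[ g ]
  Σ-cong {zero}  e = refl
  Σ-cong {suc k} e = +-cong (e zero) (Σ-cong (e ∘ suc))

  Π-cong : ∀ {k} {f g : Fin k → Carrier} → (∀ i → f i ≈ g i) → Π[ f ] ≈ Π[ g ]
  Π-cong {zero}  e = refl
  Π-cong {suc k} e = *-cong (e zero) (Π-cong (e ∘ suc))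

  Σ≡sum : ∀ {k} (f : Fin k → Carrier) → Σ[ f ] ≡ sum f
  Σ≡sum {zero}  f = ≡.refl
  Σ≡sum {suc k} f = cong (f zero +_) (Σ≡sum (f ∘ suc))

  Π≡product : ∀ {k} (f : Fin k → Carrier) → Π[ f ] ≡ product f
  Π≡product {zero}  f = ≡.refl
  Π≡product {suc k} f = cong (f zero *_) (Π≡product (f ∘ suc))

  Σ-zero : ∀ {k} {f : Fin k → Carrier} → (∀ i → f i ≈ 0#) → Σ[ f ] ≈ 0#
  Σ-zero {zero}  e = refl
  Σ-zero {suc k} e = trans (+-cong (e zero) (Σ-zero (e ∘ suc))) (+-identityʳ 0#)

  Σ-+ : ∀ {k} (f g : Fin k → Carrier) → Σ[ (λ i → f i + g i) ] ≈ Σ[ f ] + Σ[ g ]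
  Σ-+ f g rewrite Σ≡sum f | Σ≡sum g | Σ≡sum (λ i → f i + g i) = ∑-distrib-+ f g

  Σ-*ˡ : ∀ {k} t (f : Fin k → Carrier) → Σ[ (λ i → t * f i) ] ≈ t * Σ[ f ]
  Σ-*ˡ t f rewrite Σ≡sum f | Σ≡sum (λ i → t * f i) = sym (*-distribˡ-sum t f)

  Σ-linear : ∀ {k} (f : Fin k → Carrier) t (g : Fin k → Carrier) → Σ[ (λ i → f i + t * g i) ] ≈ Σ[ f ] + t * Σ[ g ]
  Σ-linear f t g = trans (Σ-+ f _) (+-congˡ (Σ-*ˡ t g))

  Σ-comm : ∀ {k l} (f : Fin k → Fin l → Carrier) →
           Σ[ (λ i → Σ[ (λ j → f i j) ]) ] ≈ Σ[ (λ j → Σ[ (λ i → f i j) ]) ]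
  Σ-comm f = begin
    Σ[ (λ i → Σ[ f i ]) ]                 ≈⟨ Σ-cong (λ i → reflexive (Σ≡sum (f i))) ⟩
    Σ[ (λ i → sum (f i)) ]                ≡⟨ Σ≡sum (λ i → sum (f i)) ⟩
    sum (λ i → sum (f i))                 ≈⟨ ∑-comm f ⟩
    sum (λ j → sum (λ i → f i j))         ≡⟨ Σ≡sum (λ j → sum (λ i → f i j)) ⟨
    Σ[ (λ j → sum (λ i → f i j)) ]        ≈⟨ Σ-cong (λ j → reflexive (Σ≡sum (λ i → f i j))) ⟨
    Σ[ (λ j → Σ[ (λ i → f i j) ]) ]       ∎

  Π-comm : ∀ {k l} (f : Fin k → Fin l → Carrier) →
           Π[ (λ i → Π[ (λ j → f i j) ]) ] ≈ Π[ (λ j → Π[ (λ i → f i j) ]) ]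
  Π-comm f = begin
    Π[ (λ i → Π[ f i ]) ]                     ≈⟨ Π-cong (λ i → reflexive (Π≡product (f i))) ⟩
    Π[ (λ i → product (f i)) ]                ≡⟨ Π≡product (λ i → product (f i)) ⟩
    product (λ i → product (f i))             ≈⟨ ∏-comm f ⟩
    product (λ j → product (λ i → f i j))     ≡⟨ Π≡product (λ j → product (λ i → f i j)) ⟨
    Π[ (λ j → product (λ i → f i j)) ]        ≈⟨ Π-cong (λ j → reflexive (Π≡product (λ i → f i j))) ⟨
    Π[ (λ j → Π[ (λ i → f i j) ]) ]           ∎

  Π-* : ∀ {k} (f g : Fin k → Carrier) → Π[ (λ i → f i * g i) ] ≈ Π[ f ] * Π[ g ]
  Π-* f g rewrite Π≡product f | Π≡product g | Π≡product (λ i → f i * g i) = ∏-distrib-* f g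

  Σ-last : ∀ {k} (f : Fin (suc k) → Carrier) → Σ[ f ] ≈ Σ[ f ∘ inject₁ ] + f (fromℕ k)
  Σ-last {zero}  f = +-comm _ _
  Σ-last {suc k} f = trans (+-congˡ (Σ-last (f ∘ suc))) (sym (+-assoc _ _ _))

  Π-last : ∀ {k} (f : Fin (suc k) → Carrier) → Π[ f ] ≈ Π[ f ∘ inject₁ ] * f (fromℕ k)
  Π-last {zero}  f = *-comm _ _
  Π-last {suc k} f = trans (*-congˡ (Π-last (f ∘ suc))) (sym (*-assoc _ _ _))

  *-cancel-zero : ∀ {x y} → ¬ (x ≈ 0#) → x * y ≈ 0# → y ≈ 0#
  *-cancel-zero {x} {y} x≉0 e with inverse x x≉0
  ... | z , xz≈1 = begin
    y             ≈⟨ *-identityˡ y ⟨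
    1# * y        ≈⟨ *-congʳ xz≈1 ⟨
    x * z * y     ≈⟨ solve 3 (λ x y z → x :* z :* y := z :* (x :* y)) refl x y z ⟩
    z * (x * y)   ≈⟨ *-congˡ e ⟩
    z * 0#        ≈⟨ zeroʳ z ⟩
    0#            ∎

  -- The vanishing of a determinant with two equal columns is drawn from its antisymmetry, which
  -- takes the invertibility of 2.
  x≈-x⇒x≈0 : ∀ {x} → x ≈ - x → x ≈ 0#
  x≈-x⇒x≈0 {x} e = *-cancel-zero {x = ⟦ 2 ⟧} (λ z → contradiction (char-zero 2 z) λ ()) (begin
    ⟦ 2 ⟧ * x  ≈⟨ solve 1 (λ x → (con (1 , 0) :+ (con (1 , 0) :+ con (0 , 0))) :* x := x :+ x) refl x ⟩
    x + x      ≈⟨ +-congˡ e ⟩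
    x - x      ≈⟨ -‿inverseʳ x ⟩
    0#         ∎)

  -- Determinants

  _ᵀ : ∀ {m} → Mat m → Mat m
  (A ᵀ) i j = A j i

  laplaceTerm : ∀ {m} → Mat (suc m) → Fin (suc m) → Carrier
  laplaceTerm A j = sgn (toℕ j) * (A zero j * det (minor A j))

  det-cong : ∀ {m} {A B : Mat m} → (∀ i j → A i j ≈ B i j) → det A ≈ det B
  det-cong {zero}  e = refl
  det-cong {suc m} {A} {B} e = Σ-cong {f = laplaceTerm A} {g = laplaceTerm B} λ j →
    *-congˡ (*-cong (e zero j) (det-cong λ r s → e (suc r) (punchIn j s)))

  -- Three matrices that agree off column p, rather than an update of one matrix, give a hypothesis
  -- that passes to minors: in the term of column j ≠ p the distinguished column survives at
  -- `punchOut j≢p`, while in the term of p itself only the entry of the first row varies.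
  det-linear : ∀ {m} (p : Fin m) t {A B C : Mat m} →
               (∀ i j → j ≢ p → C i j ≈ A i j) → (∀ i j → j ≢ p → B i j ≈ A i j) →
               (∀ i → C i p ≈ A i p + t * B i p) → det C ≈ det A + t * det B
  det-linear {suc m} p t {A} {B} {C} C≈A B≈A C≈A+tB = trans (Σ-cong term) (Σ-linear (laplaceTerm A) t (laplaceTerm B))
    where
    term : ∀ j → laplaceTerm C j ≈ laplaceTerm A j + t * laplaceTerm B j
    term j with j Fin.≟ p
    ... | yes ≡.refl = begin
      sgn (toℕ p) * (C zero p * det (minor C p))
        ≈⟨ *-congˡ (*-cong (C≈A+tB zero) (det-cong λ r s → C≈A (suc r) _ (Finₚ.punchInᵢ≢i p s))) ⟩
      sgn (toℕ p) * ((A zero p + t * B zero p) * det (minor A p))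
        ≈⟨ solve 5 (λ s a t b d → s :* ((a :+ t :* b) :* d) := s :* (a :* d) :+ t :* (s :* (b :* d))) refl _ _ t _ _ ⟩
      sgn (toℕ p) * (A zero p * det (minor A p)) + t * (sgn (toℕ p) * (B zero p * det (minor A p)))
        ≈⟨ +-congˡ (*-congˡ (*-congˡ (*-congˡ (det-cong λ r s → B≈A (suc r) _ (Finₚ.punchInᵢ≢i p s))))) ⟨
      _ ∎
    ... | no j≢p = begin
      sgn (toℕ j) * (C zero j * det (minor C j))
        ≈⟨ *-congˡ (*-cong (C≈A zero j j≢p) (det-linear q t
             (λ r s s≢q → C≈A _ _ (off s≢q)) (λ r s s≢q → B≈A _ _ (off s≢q))
             (λ r → subst (λ x → C (suc r) x ≈ A (suc r) x + t * B (suc r) x) (≡.sym (Finₚ.punchIn-punchOut j≢p)) (C≈A+tB (suc r))))) ⟩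
      sgn (toℕ j) * (A zero j * (det (minor A j) + t * det (minor B j)))
        ≈⟨ solve 5 (λ s a t c d → s :* (a :* (c :+ t :* d)) := s :* (a :* c) :+ t :* (s :* (a :* d))) refl _ _ t _ _ ⟩
      sgn (toℕ j) * (A zero j * det (minor A j)) + t * (sgn (toℕ j) * (A zero j * det (minor B j)))
        ≈⟨ +-congˡ (*-congˡ (*-congˡ (*-congʳ (B≈A zero j j≢p)))) ⟨
      _ ∎
      where
      q = punchOut j≢p
      off : ∀ {s} → s ≢ q → punchIn j s ≢ p
      off s≢q e = s≢q (Finₚ.punchIn-injective j _ _ (≡.trans e (≡.sym (Finₚ.punchIn-punchOut j≢p))))

  -- Expanding the minors of the first row along their first columns, and those of
  -- the first column along their first rows, yields the same double sum.
  det-ᵀ : ∀ {m} (A : Mat m) → det A ≈ det (A ᵀ)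
  det-ᵀ {zero}        A = refl
  det-ᵀ {suc zero}    A = refl
  det-ᵀ {suc (suc m)} A = +-cong (*-congˡ (*-congˡ (det-ᵀ (minor A zero)))) (begin
    Σ[ (λ j → laplaceTerm A (suc j)) ]                ≈⟨ Σ-cong (λ j → expand-minor A (suc j) (det-ᵀ (minor A (suc j)))) ⟩
    Σ[ (λ j → Σ[ (λ i → twofold A (suc j) i) ]) ]  ≈⟨ Σ-comm (λ j i → twofold A (suc j) i) ⟩
    Σ[ (λ i → Σ[ (λ j → twofold A (suc j) i) ]) ]  ≈⟨ Σ-cong (λ i → Σ-cong (λ j → exchange i j)) ⟩
    Σ[ (λ i → Σ[ (λ j → twofold (A ᵀ) (suc i) j) ]) ] ≈⟨ Σ-cong (λ i → expand-minor (A ᵀ) (suc i) (det-ᵀ (minor (A ᵀ) (suc i)))) ⟨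
    Σ[ (λ i → laplaceTerm (A ᵀ) (suc i)) ]            ∎)
    where
    twofold : Mat (suc (suc m)) → Fin (suc (suc m)) → Fin (suc m) → Carrier
    twofold B j i = sgn (toℕ j) * (B zero j * laplaceTerm (minor B j ᵀ) i)
    expand-minor : ∀ B j → det (minor B j) ≈ det (minor B j ᵀ) → laplaceTerm B j ≈ Σ[ twofold B j ]
    expand-minor B j e = begin
      sgn (toℕ j) * (B zero j * det (minor B j))                           ≈⟨ *-congˡ (*-congˡ e) ⟩
      sgn (toℕ j) * (B zero j * Σ[ laplaceTerm (minor B j ᵀ) ])               ≈⟨ *-congˡ (Σ-*ˡ (B zero j) (laplaceTerm (minor B j ᵀ))) ⟨
      sgn (toℕ j) * Σ[ (λ i → B zero j * laplaceTerm (minor B j ᵀ) i) ]       ≈⟨ Σ-*ˡ (sgn (toℕ j)) (λ i → B zero j * laplaceTerm (minor B j ᵀ) i) ⟨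
      Σ[ twofold B j ]                                                     ∎
    exchange : ∀ i j → twofold A (suc j) i ≈ twofold (A ᵀ) (suc i) j
    exchange i j = trans
      (*-congˡ {x = - sgn (toℕ j)} (*-congˡ {x = A zero (suc j)} (*-congˡ {x = sgn (toℕ i)} (*-congˡ {x = A (suc i) zero}
        (det-ᵀ (λ r s → A (suc (punchIn i s)) (suc (punchIn j r))))))))
      (solve 5 (λ s a t b d → :- s :* (a :* (t :* (b :* d))) := :- t :* (b :* (s :* (a :* d)))) refl
        (sgn (toℕ j)) (A zero (suc j)) (sgn (toℕ i)) (A (suc i) zero) (det (λ r s → A (suc (punchIn i r)) (suc (punchIn j s)))))

  swap₀₁ : ∀ {m} → Fin (suc (suc m)) → Fin (suc (suc m))
  swap₀₁ zero          = suc zero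
  swap₀₁ (suc zero)    = zero
  swap₀₁ (suc (suc j)) = suc (suc j)

  -- The terms of columns 0 and 1 trade places and differ in sign. Every other minor still begins
  -- with these two columns, so induction applies to it.
  det-swap₀₁ : ∀ {m} (A : Mat (suc (suc m))) → det (λ i j → A i (swap₀₁ j)) ≈ - det A
  det-swap₀₁ {m} A = begin
    1# * (A zero (suc zero) * det (minor A′ zero)) + (- 1# * (A zero zero * det (minor A′ (suc zero))) + Σ[ (λ j → laplaceTerm A′ (suc (suc j))) ])
      ≈⟨ +-cong (*-congˡ (*-congˡ (det-cong {A = minor A′ zero} {B = minor A (suc zero)} λ { r zero → refl ; r (suc s) → refl })))
         (+-cong (*-congˡ (*-congˡ (det-cong {A = minor A′ (suc zero)} {B = minor A zero} λ { r zero → refl ; r (suc s) → refl }))) (rest A)) ⟩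
    1# * (A zero (suc zero) * det (minor A (suc zero))) + (- 1# * (A zero zero * det (minor A zero)) + - 1# * Σ[ (λ j → laplaceTerm A (suc (suc j))) ])
      ≈⟨ solve 5 (λ a b c d e → con (1 , 0) :* (a :* b) :+ (:- con (1 , 0) :* (c :* d) :+ :- con (1 , 0) :* e)
           := :- (con (1 , 0) :* (c :* d) :+ (:- con (1 , 0) :* (a :* b) :+ e))) refl
           (A zero (suc zero)) (det (minor A (suc zero))) (A zero zero) (det (minor A zero)) Σ[ (λ j → laplaceTerm A (suc (suc j))) ] ⟩
    - det A ∎
    where
    A′ : Mat (suc (suc m))
    A′ i j = A i (swap₀₁ j)
    rest : ∀ {m} (A : Mat (suc (suc m))) →
      Σ[ (λ j → laplaceTerm (λ i j → A i (swap₀₁ j)) (suc (suc j))) ] ≈ - 1# * Σ[ (λ j → laplaceTerm A (suc (suc j))) ]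
    rest {zero} A = sym (zeroʳ _)
    rest {suc m} A = trans (Σ-cong {f = λ j → laplaceTerm (λ i j → A i (swap₀₁ j)) (suc (suc j))} {g = λ j → - 1# * laplaceTerm A (suc (suc j))} λ j → let N = minor A (suc (suc j)) in trans
      (*-congˡ {x = sgn (toℕ (suc (suc j)))} (*-congˡ {x = A zero (suc (suc j))} (trans
        (det-cong {A = minor (λ i j → A i (swap₀₁ j)) (suc (suc j))} {B = λ i j → N i (swap₀₁ j)} λ { r zero → refl ; r (suc zero) → refl ; r (suc (suc s)) → refl })
        (det-swap₀₁ N))))
      (solve 3 (λ s a d → s :* (a :* :- d) := :- con (1 , 0) :* (s :* (a :* d))) refl (sgn (toℕ (suc (suc j)))) (A zero (suc (suc j))) (det N)))
      (Σ-*ˡ (- 1#) (λ j → laplaceTerm A (suc (suc j))))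

  mutual
    -- If neither of the columns is the first, expansion along the first column leaves both in every
    -- minor. If one is the first and the other the second, antisymmetry decides. Otherwise `swap₀₁`
    -- moves the first column to second place and so leads back to the first case.
    det-equal-columns : ∀ {m} (A : Mat m) p q → p ≢ q → (∀ i → A i p ≈ A i q) → det A ≈ 0#
    det-equal-columns A zero zero p≢q e = contradiction ≡.refl p≢q
    det-equal-columns A zero (suc q) _ e = det-equal-columns-zero A q e
    det-equal-columns A (suc p) zero _ e = det-equal-columns-zero A p (sym ∘ e)
    det-equal-columns A (suc p) (suc q) p≢q e = det-equal-columns-suc A p q (p≢q ∘ cong suc) e

    det-equal-columns-suc : ∀ {m} (A : Mat (suc m)) p q → p ≢ q → (∀ i → A i (suc p) ≈ A i (suc q)) → det A ≈ 0#
    det-equal-columns-suc A p q p≢q e = trans (det-ᵀ A) (Σ-zero {f = laplaceTerm (A ᵀ)} λ i →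
      trans (*-congˡ (trans (*-congˡ (trans (det-ᵀ (minor (A ᵀ) i))
        (det-equal-columns (minor (A ᵀ) i ᵀ) p q p≢q λ r → e (punchIn i r)))) (zeroʳ _))) (zeroʳ _))

    det-equal-columns-zero : ∀ {m} (A : Mat (suc m)) q → (∀ i → A i zero ≈ A i (suc q)) → det A ≈ 0#
    det-equal-columns-zero {suc m} A zero e = x≈-x⇒x≈0 (trans
      (det-cong {A = A} {B = λ i j → A i (swap₀₁ j)} λ { i zero → e i ; i (suc zero) → sym (e i) ; i (suc (suc j)) → refl }) (det-swap₀₁ A))
    det-equal-columns-zero {suc m} A (suc q) e = begin
      det A       ≈⟨ -‿involutive _ ⟨
      - - det A   ≈⟨ -‿cong (det-swap₀₁ A) ⟨
      - det (λ i j → A i (swap₀₁ j)) ≈⟨ -‿cong (det-equal-columns-suc (λ i j → A i (swap₀₁ j)) zero (suc q) (λ ()) e) ⟩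
      - 0#        ≈⟨ ε⁻¹≈ε ⟩
      0#          ∎

  -- Column operations and determinants of special shape

  replaceColumn : ∀ {m} → Mat m → Fin m → (Fin m → Carrier) → Mat m
  replaceColumn A p v i j with j Fin.≟ p
  ... | yes _ = v i
  ... | no  _ = A i j

  replaceColumn-at : ∀ {m} (A : Mat m) p v i → replaceColumn A p v i p ≈ v i
  replaceColumn-at A p v i with p Fin.≟ p
  ... | yes _ = refl
  ... | no  p≢p = contradiction ≡.refl p≢p

  replaceColumn-off : ∀ {m} (A : Mat m) p v i j → j ≢ p → replaceColumn A p v i j ≈ A i j
  replaceColumn-off A p v i j j≢p with j Fin.≟ p
  ... | yes j≡p = contradiction j≡p j≢p
  ... | no  _ = refl

  det-add-multiple : ∀ {m} {p q : Fin m} → p ≢ q → ∀ t {A C : Mat m} → (∀ i j → j ≢ p → C i j ≈ A i j) →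
                     (∀ i → C i p ≈ A i p + t * A i q) → det C ≈ det A
  det-add-multiple {m} {p} {q} p≢q t {A} {C} off at = begin
    det C              ≈⟨ det-linear p t off (replaceColumn-off A p v) (λ i → trans (at i) (+-congˡ (*-congˡ (sym (replaceColumn-at A p v i))))) ⟩
    det A + t * det B  ≈⟨ +-congˡ (*-congˡ (det-equal-columns B p q p≢q λ i → trans (replaceColumn-at A p v i) (sym (replaceColumn-off A p v i q (p≢q ∘ ≡.sym))))) ⟩
    det A + t * 0#     ≈⟨ solve 2 (λ a t → a :+ t :* con (0 , 0) := a) refl (det A) t ⟩
    det A              ∎
    where
    v : Fin m → Carrier
    v i = A i q
    B : Mat m
    B = replaceColumn A p v

  -- For a zero column, linearity with all three matrices equal to A reads det A = det A + det A.
  det-zero-column : ∀ {m} (A : Mat m) p → (∀ i → A i p ≈ 0#) → det A ≈ 0#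
  det-zero-column A p z = begin
    det A                       ≈⟨ solve 1 (λ x → x := x :+ con (1 , 0) :* x :- x) refl (det A) ⟩
    det A + 1# * det A - det A  ≈⟨ +-congʳ (det-linear p 1# {A} {A} {A} (λ _ _ _ → refl) (λ _ _ _ → refl) (λ i →
                                     trans (z i) (sym (trans (+-cong (z i) (*-congˡ (z i))) (trans (+-identityˡ _) (zeroʳ 1#)))))) ⟨
    det A - det A               ≈⟨ -‿inverseʳ _ ⟩
    0#                          ∎

  det-scale : ∀ {m} t (A : Mat m) → det (λ i j → t * A i j) ≈ t ^ m * det A
  det-scale {zero}  t A = sym (*-identityˡ 1#)
  det-scale {suc m} t A = trans
    (Σ-cong {f = laplaceTerm (λ i j → t * A i j)} {g = λ j → t ^ suc m * laplaceTerm A j} λ j →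
      trans (*-congˡ (*-congˡ (det-scale t (minor A j))))
        (solve 5 (λ s t a u d → s :* ((t :* a) :* (u :* d)) := (t :* u) :* (s :* (a :* d))) refl (sgn (toℕ j)) t (A zero j) (t ^ m) (det (minor A j))))
    (Σ-*ˡ (t ^ suc m) (laplaceTerm A))

  punchIn-inject₁-fromℕ : ∀ {m} (j : Fin (suc m)) → punchIn (inject₁ j) (fromℕ m) ≡ fromℕ (suc m)
  punchIn-inject₁-fromℕ         zero    = ≡.refl
  punchIn-inject₁-fromℕ {suc m} (suc j) = cong suc (punchIn-inject₁-fromℕ j)

  punchIn-inject₁-inject₁ : ∀ {m} (j : Fin (suc m)) s → punchIn (inject₁ j) (inject₁ s) ≡ inject₁ (punchIn j s)
  punchIn-inject₁-inject₁ zero    s       = ≡.refl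
  punchIn-inject₁-inject₁ (suc j) zero    = ≡.refl
  punchIn-inject₁-inject₁ (suc j) (suc s) = cong suc (punchIn-inject₁-inject₁ j s)

  punchIn-fromℕ : ∀ {m} (s : Fin m) → punchIn (fromℕ m) s ≡ inject₁ s
  punchIn-fromℕ zero    = ≡.refl
  punchIn-fromℕ (suc s) = cong suc (punchIn-fromℕ s)

  det-last-column : ∀ {m} (A : Mat (suc m)) → (∀ i → A (inject₁ i) (fromℕ m) ≈ 0#) →
                    det A ≈ A (fromℕ m) (fromℕ m) * det (block A)
  det-last-column {zero} A z = solve 1 (λ a → con (1 , 0) :* (a :* con (1 , 0)) :+ con (0 , 0) := a :* con (1 , 0)) refl (A zero zero)
  det-last-column {suc m} A z = begin
    Σ[ laplaceTerm A ]
      ≈⟨ Σ-last (laplaceTerm A) ⟩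
    Σ[ (λ j → laplaceTerm A (inject₁ j)) ] + laplaceTerm A (fromℕ (suc m))
      ≈⟨ +-cong (Σ-cong {f = λ j → laplaceTerm A (inject₁ j)} {g = λ j → t * laplaceTerm (block A) j} term)
           (trans (*-congˡ {x = sgn (toℕ (fromℕ (suc m)))} (trans (*-congʳ (z zero)) (zeroˡ _))) (zeroʳ _)) ⟩
    Σ[ (λ j → t * laplaceTerm (block A) j) ] + 0#
      ≈⟨ +-identityʳ _ ⟩
    Σ[ (λ j → t * laplaceTerm (block A) j) ]
      ≈⟨ Σ-*ˡ t (laplaceTerm (block A)) ⟩
    t * det (block A) ∎
    where
    t = A (fromℕ (suc m)) (fromℕ (suc m))
    term : ∀ j → laplaceTerm A (inject₁ j) ≈ t * laplaceTerm (block A) j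
    term j = begin
      sgn (toℕ (inject₁ j)) * (a * det N)
        ≈⟨ *-cong (reflexive (cong sgn (Finₚ.toℕ-inject₁ j))) (*-congˡ (det-last-column N λ i →
             trans (reflexive (cong (A (suc (inject₁ i))) (punchIn-inject₁-fromℕ j))) (z (suc i)))) ⟩
      sgn (toℕ j) * (a * (N (fromℕ m) (fromℕ m) * det (block N)))
        ≈⟨ *-congˡ (*-congˡ (*-cong (reflexive (cong (A (fromℕ (suc m))) (punchIn-inject₁-fromℕ j)))
             (det-cong {A = block N} {B = minor (block A) j} λ r s → reflexive (cong (A (suc (inject₁ r))) (punchIn-inject₁-inject₁ j s))))) ⟩
      sgn (toℕ j) * (a * (t * det (minor (block A) j)))
        ≈⟨ solve 4 (λ s a t d → s :* (a :* (t :* d)) := t :* (s :* (a :* d))) refl (sgn (toℕ j)) a t (det (minor (block A) j)) ⟩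
      t * (sgn (toℕ j) * (a * det (minor (block A) j))) ∎
      where
      N = minor A (inject₁ j)
      a = A zero (inject₁ j)

  -- The recursion of the exponent n(n-1)/2 that matches expansion along the first row: the
  -- antidiagonal entry there stands in column m and has sign `sgn m`.
  triangle : ∀ m → (suc m ℕ.* m) / 2 ≡ m ℕ.+ (m ℕ.* (m ℕ.∸ 1)) / 2
  triangle zero    = ≡.refl
  triangle (suc m) = ≡.trans (cong (_/ 2) (expanded m))
    (≡.trans (+-distrib-/-∣ˡ (suc m ℕ.* m) (n∣m*n (suc m))) (cong (ℕ._+ (suc m ℕ.* m) / 2) (m*n/n≡m (suc m) 2)))
    where
    open ℕSolver renaming (solve to ℕsolve; _:=_ to _:≡_; _:+_ to _⊕_; _:*_ to _⊛_; con to lit)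
    expanded : ∀ m → suc (suc m) ℕ.* suc m ≡ suc m ℕ.* 2 ℕ.+ suc m ℕ.* m
    expanded = ℕsolve 1 (λ m → (lit 2 ⊕ m) ⊛ (lit 1 ⊕ m) :≡ (lit 1 ⊕ m) ⊛ lit 2 ⊕ (lit 1 ⊕ m) ⊛ m) ≡.refl

  sgn-+ : ∀ k l → sgn (k ℕ.+ l) ≈ sgn k * sgn l
  sgn-+ zero    l = sym (*-identityˡ _)
  sgn-+ (suc k) l = trans (-‿cong (sgn-+ k l)) (-‿distribˡ-* _ _)

  -- The first row itself may be full; what vanishes is each minor that omits a column other than
  -- the last, because it retains a last column of zeros (`minor-zero`). Indexing entries by ℕ makes
  -- the surviving minor a mere shift `h ∘ suc`.
  det-antitriangular : ∀ m (h : ℕ → ℕ → Carrier) (g : ℕ → Carrier) → (∀ i j → m ℕ.≤ i ℕ.+ j → h i j ≈ 0#) →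
                       (∀ i j → suc (i ℕ.+ j) ≡ m → h i j ≈ g i) →
                       det {m} (λ i j → h (toℕ i) (toℕ j)) ≈ sgn ((m ℕ.* (m ℕ.∸ 1)) / 2) * Π[ (λ (i : Fin m) → g (toℕ i)) ]
  det-antitriangular zero h g z d = sym (*-identityˡ 1#)
  det-antitriangular (suc m) h g z d = begin
    Σ[ laplaceTerm A ]
      ≈⟨ Σ-last (laplaceTerm A) ⟩
    Σ[ (λ j → laplaceTerm A (inject₁ j)) ] + laplaceTerm A (fromℕ m)
      ≈⟨ +-congʳ (Σ-zero {f = λ j → laplaceTerm A (inject₁ j)} λ j →
           trans (*-congˡ (trans (*-congˡ (minor-zero h z j)) (zeroʳ _))) (zeroʳ _)) ⟩
    0# + laplaceTerm A (fromℕ m)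
      ≈⟨ +-identityˡ _ ⟩
    sgn (toℕ (fromℕ m)) * (h 0 (toℕ (fromℕ m)) * det (minor A (fromℕ m)))
      ≈⟨ *-cong (reflexive (cong sgn (Finₚ.toℕ-fromℕ m))) (*-cong (trans (reflexive (cong (h 0) (Finₚ.toℕ-fromℕ m))) (d 0 m ≡.refl))
           (trans (det-cong {A = minor A (fromℕ m)} {B = λ r s → h (suc (toℕ r)) (toℕ s)} λ r s →
                    reflexive (cong (h (suc (toℕ r))) (≡.trans (cong toℕ (punchIn-fromℕ s)) (Finₚ.toℕ-inject₁ s))))
             (det-antitriangular m (h ∘ suc) (g ∘ suc) (λ i j le → z (suc i) j (ℕ.s≤s le)) (λ i j e → d (suc i) j (cong suc e))))) ⟩
    sgn m * (g 0 * (S * P))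
      ≈⟨ solve 4 (λ s g t p → s :* (g :* (t :* p)) := s :* t :* (g :* p)) refl (sgn m) (g 0) S P ⟩
    sgn m * S * (g 0 * P)
      ≈⟨ *-congʳ (sgn-+ m _) ⟨
    sgn (m ℕ.+ (m ℕ.* (m ℕ.∸ 1)) / 2) * (g 0 * P)
      ≡⟨ cong (λ k → sgn k * (g 0 * P)) (triangle m) ⟨
    sgn ((suc m ℕ.* m) / 2) * (g 0 * P) ∎
    where
    A : Mat (suc m)
    A i j = h (toℕ i) (toℕ j)
    S = sgn ((m ℕ.* (m ℕ.∸ 1)) / 2)
    P = Π[ (λ (i : Fin m) → g (suc (toℕ i))) ]
    minor-zero : ∀ {m} (h : ℕ → ℕ → Carrier) → (∀ i j → suc m ℕ.≤ i ℕ.+ j → h i j ≈ 0#) → ∀ (j : Fin m) →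
                 det {m} (minor (λ i j → h (toℕ i) (toℕ j)) (inject₁ j)) ≈ 0#
    minor-zero {suc m} h z j = det-zero-column (minor (λ i j → h (toℕ i) (toℕ j)) (inject₁ j)) (fromℕ m) λ r →
      trans (reflexive (cong (h (suc (toℕ r))) (≡.trans (cong toℕ (punchIn-inject₁-fromℕ j)) (Finₚ.toℕ-fromℕ (suc m)))))
        (z (suc (toℕ r)) (suc m) (ℕ.s≤s (ℕₚ.m≤n+m (suc m) (toℕ r))))

  -- Unitriangular changes of columns

  -- Linear combinations of β 0, ..., β (k - 1), with the coefficient of the last vector outermost,
  -- so that recursion on the derivation removes one column multiple at a time. Pointwise equations
  -- are stored because vectors are functions.
  data InSpan {m} (β : ℕ → Fin m → Carrier) : ℕ → (Fin m → Carrier) → Set (c ⊔ ℓ) where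
    null   : ∀ {v} → (∀ i → v i ≈ 0#) → InSpan β zero v
    extend : ∀ {k v w} t → InSpan β k w → (∀ i → v i ≈ w i + t * β k i) → InSpan β (suc k) v

  -- Each `extend` is one column operation: its multiple of β k is a multiple of column k, which
  -- lies to the left of p and therefore is already a β.
  det-add-span : ∀ {m} (β : ℕ → Fin m → Carrier) (p : Fin m) k → k ℕ.≤ toℕ p → ∀ v → InSpan β k v →
                 ∀ (A C : Mat m) → (∀ i j → toℕ j ℕ.< toℕ p → A i j ≈ β (toℕ j) i) →
                 (∀ i j → j ≢ p → C i j ≈ A i j) → (∀ i → C i p ≈ A i p + v i) → det C ≈ det A
  det-add-span β p zero le v (null v≈0) A C A≈β off at = det-cong entry
    where
    entry : ∀ i j → C i j ≈ A i j
    entry i j with j Fin.≟ p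
    ... | yes ≡.refl = trans (at i) (trans (+-congˡ (v≈0 i)) (+-identityʳ _))
    ... | no j≢p = off i j j≢p
  det-add-span {m} β p (suc k) k<p v (extend {w = w} t w∈ v≈) A C A≈β off at = trans
    (det-add-multiple p≢q t (λ i j j≢p → trans (off i j j≢p) (sym (replaceColumn-off A p u i j j≢p))) (λ i → begin
      C i p                        ≈⟨ at i ⟩
      A i p + v i                  ≈⟨ +-congˡ (v≈ i) ⟩
      A i p + (w i + t * β k i)    ≈⟨ +-assoc _ _ _ ⟨
      u i + t * β k i              ≈⟨ +-cong (sym (replaceColumn-at A p u i)) (*-congˡ (sym (begin
         B i q            ≈⟨ replaceColumn-off A p u i q (p≢q ∘ ≡.sym) ⟩
         A i q            ≈⟨ A≈β i q (subst (ℕ._< toℕ p) (≡.sym q≡k) k<p) ⟩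
         β (toℕ q) i      ≡⟨ cong (λ x → β x i) q≡k ⟩
         β k i            ∎))) ⟩
      B i p + t * B i q            ∎))
    (det-add-span β p k (ℕₚ.<⇒≤ k<p) w w∈ A B A≈β (replaceColumn-off A p u) (replaceColumn-at A p u))
    where
    u : Fin m → Carrier
    u i = A i p + w i
    B : Mat m
    B = replaceColumn A p u
    k<m = ℕₚ.<-trans k<p (Finₚ.toℕ<n p)
    q = fromℕ< k<m
    q≡k : toℕ q ≡ k
    q≡k = Finₚ.toℕ-fromℕ< k<m
    p≢q : p ≢ q
    p≢q e = ℕₚ.<-irrefl (≡.trans (≡.sym q≡k) (cong toℕ (≡.sym e))) k<p

  -- Columns are exchanged from the left, with `H k` having β in its first k columns and γ
  -- afterwards. When column k is treated, the columns that span the difference are then already in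
  -- place.
  det-unitriangular : ∀ {m} (β γ : ℕ → Fin m → Carrier) → (∀ k → InSpan β k (λ i → γ k i - β k i)) →
                      det (λ i j → γ (toℕ j) i) ≈ det (λ i j → β (toℕ j) i)
  det-unitriangular {m} β γ γ-β = trans (sym (det-cong {A = H 0} λ i j → refl))
    (trans (steps m ℕₚ.≤-refl) (det-cong {A = H m} (λ i j → H-< m i j (Finₚ.toℕ<n j))))
    where
    H : ℕ → Mat m
    H k i j with toℕ j ℕ.<? k
    ... | yes _ = β (toℕ j) i
    ... | no  _ = γ (toℕ j) i
    H-< : ∀ k i j → toℕ j ℕ.< k → H k i j ≈ β (toℕ j) i
    H-< k i j lt with toℕ j ℕ.<? k
    ... | yes _ = refl
    ... | no ≮ = contradiction lt ≮
    H-≮ : ∀ k i j → ¬ (toℕ j ℕ.< k) → H k i j ≈ γ (toℕ j) i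
    H-≮ k i j ≮ with toℕ j ℕ.<? k
    ... | yes lt = contradiction lt ≮
    ... | no _ = refl
    step : ∀ p → det (H (toℕ p)) ≈ det (H (suc (toℕ p)))
    step p = det-add-span β p k ℕₚ.≤-refl _ (γ-β k) (H (suc k)) (H k)
      (λ i j lt → H-< (suc k) i j (ℕₚ.m<n⇒m<1+n lt)) off
      (λ i → begin
        H k i p                            ≈⟨ H-≮ k i p (ℕₚ.<-irrefl ≡.refl) ⟩
        γ k i                              ≈⟨ solve 2 (λ b g → g := b :+ (g :- b)) refl (β k i) (γ k i) ⟩
        β k i + (γ k i - β k i)            ≈⟨ +-congʳ (H-< (suc k) i p (ℕₚ.n<1+n k)) ⟨
        H (suc k) i p + (γ k i - β k i)    ∎)
      where
      k = toℕ p
      off : ∀ i j → j ≢ p → H k i j ≈ H (suc k) i j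
      off i j j≢p with ℕₚ.<-cmp (toℕ j) k
      ... | tri< lt _ _ = trans (H-< k i j lt) (sym (H-< (suc k) i j (ℕₚ.m<n⇒m<1+n lt)))
      ... | tri≈ _ e _ = contradiction (Finₚ.toℕ-injective e) j≢p
      ... | tri> ≮ _ gt = trans (H-≮ k i j ≮) (sym (H-≮ (suc k) i j (ℕₚ.≤⇒≯ gt)))
    steps : ∀ k → k ℕ.≤ m → det (H 0) ≈ det (H k)
    steps zero _ = refl
    steps (suc k) lt = trans (steps k (ℕₚ.<⇒≤ lt))
      (subst (λ x → det (H x) ≈ det (H (suc x))) (Finₚ.toℕ-fromℕ< lt) (step (fromℕ< lt)))

  -- Vectors, dot products and linear functionals

  Vector : ℕ → Set c
  Vector m = Fin m → Carrier

  -- The entries of `I` again, but by recursion instead of a test for equality, so that they reduce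
  -- under `suc` in inductions on the dimension.
  δ : ∀ {m} → Fin m → Vector m
  δ zero    zero    = 1#
  δ zero    (suc j) = 0#
  δ (suc i) zero    = 0#
  δ (suc i) (suc j) = δ i j

  δ-diagonal : ∀ {m} (i : Fin m) → δ i i ≡ 1#
  δ-diagonal zero    = ≡.refl
  δ-diagonal (suc i) = δ-diagonal i

  δ-off : ∀ {m} (i j : Fin m) → i ≢ j → δ i j ≡ 0#
  δ-off zero    zero    i≢j = contradiction ≡.refl i≢j
  δ-off zero    (suc j) i≢j = ≡.refl
  δ-off (suc i) zero    i≢j = ≡.refl
  δ-off (suc i) (suc j) i≢j = δ-off i j (i≢j ∘ cong suc)

  δ-sym : ∀ {m} (i j : Fin m) → δ i j ≡ δ j i
  δ-sym zero    zero    = ≡.refl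
  δ-sym zero    (suc j) = ≡.refl
  δ-sym (suc i) zero    = ≡.refl
  δ-sym (suc i) (suc j) = δ-sym i j

  δ-inject₁ : ∀ {m} (i j : Fin m) → δ (inject₁ i) (inject₁ j) ≡ δ i j
  δ-inject₁ zero    zero    = ≡.refl
  δ-inject₁ zero    (suc j) = ≡.refl
  δ-inject₁ (suc i) zero    = ≡.refl
  δ-inject₁ (suc i) (suc j) = δ-inject₁ i j

  δ-fromℕ-inject₁ : ∀ {m} (j : Fin m) → δ (fromℕ m) (inject₁ j) ≡ 0#
  δ-fromℕ-inject₁ {m} j = δ-off (fromℕ m) (inject₁ j) Finₚ.fromℕ≢inject₁

  I≈δ : ∀ {m} (i j : Fin m) → I i j ≈ δ i j
  I≈δ i j with i Finₚ.≟ j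
  ... | yes ≡.refl = reflexive (≡.sym (δ-diagonal i))
  ... | no i≢j = reflexive (≡.sym (δ-off i j i≢j))

  scal≈δ : ∀ {m} x (i j : Fin m) → scal x i j ≈ x * δ i j
  scal≈δ x i j with i Finₚ.≟ j
  ... | yes ≡.refl = sym (trans (*-congˡ (reflexive (δ-diagonal i))) (*-identityʳ x))
  ... | no i≢j = sym (trans (*-congˡ (reflexive (δ-off i j i≢j))) (zeroʳ x))

  dot : ∀ {m} → Vector m → Vector m → Carrier
  dot u v = Σ[ (λ i → u i * v i) ]

  dot-cong : ∀ {m} {u u' v v' : Vector m} → (∀ i → u i ≈ u' i) → (∀ i → v i ≈ v' i) → dot u v ≈ dot u' v'
  dot-cong e e' = Σ-cong λ i → *-cong (e i) (e' i)

  dot-comm : ∀ {m} (u v : Vector m) → dot u v ≈ dot v u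
  dot-comm u v = Σ-cong λ i → *-comm (u i) (v i)

  dot-linearʳ : ∀ {m} (u v : Vector m) t w → dot u (λ i → v i + t * w i) ≈ dot u v + t * dot u w
  dot-linearʳ u v t w = trans
    (Σ-cong λ i → solve 4 (λ u v t w → u :* (v :+ t :* w) := u :* v :+ t :* (u :* w)) refl (u i) (v i) t (w i))
    (Σ-linear (λ i → u i * v i) t (λ i → u i * w i))

  dot-linearˡ : ∀ {m} (v : Vector m) t w u → dot (λ i → v i + t * w i) u ≈ dot v u + t * dot w u
  dot-linearˡ v t w u = trans (dot-comm _ u) (trans (dot-linearʳ u v t w) (+-cong (dot-comm u v) (*-congˡ (dot-comm u w))))

  dot-zeroˡ : ∀ {m} (u v : Vector m) → (∀ i → u i ≈ 0#) → dot u v ≈ 0#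
  dot-zeroˡ u v z = Σ-zero λ i → trans (*-congʳ (z i)) (zeroˡ (v i))

  dot-zeroʳ : ∀ {m} (u v : Vector m) → (∀ i → v i ≈ 0#) → dot u v ≈ 0#
  dot-zeroʳ u v z = Σ-zero λ i → trans (*-congˡ (z i)) (zeroʳ (u i))

  dot-δ : ∀ {m} (k : Fin m) (v : Vector m) → dot (δ k) v ≈ v k
  dot-δ zero v = trans (+-cong (*-identityˡ (v zero)) (dot-zeroˡ (λ _ → 0#) (v ∘ suc) (λ _ → refl))) (+-identityʳ _)
  dot-δ (suc k) v = trans (+-cong (zeroˡ (v zero)) (dot-δ k (v ∘ suc))) (+-identityˡ _)

  infixr 8 _⊛_

  _⊛_ : ∀ {m} → Mat m → Vector m → Vector m
  (A ⊛ v) i = dot (A i) v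

  dot-adjoint : ∀ {m} (A : Mat m) u v → dot ((A ᵀ) ⊛ u) v ≈ dot u (A ⊛ v)
  dot-adjoint A u v = begin
    Σ[ (λ i → Σ[ (λ j → A j i * u j) ] * v i) ]    ≈⟨ Σ-cong (λ i → trans (*-comm _ (v i)) (sym (Σ-*ˡ (v i) (λ j → A j i * u j)))) ⟩
    Σ[ (λ i → Σ[ (λ j → v i * (A j i * u j)) ]) ]  ≈⟨ Σ-comm (λ i j → v i * (A j i * u j)) ⟩
    Σ[ (λ j → Σ[ (λ i → v i * (A j i * u j)) ]) ]  ≈⟨ Σ-cong (λ j → trans (Σ-cong λ i → solve 3 (λ v a u → v :* (a :* u) := u :* (a :* v)) refl (v i) (A j i) (u j)) (Σ-*ˡ (u j) (λ i → A j i * v i))) ⟩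
    Σ[ (λ j → u j * Σ[ (λ i → A j i * v i) ]) ]    ∎

  -- Serves as Laplace expansion along an arbitrary column: for a determinant viewed as a function
  -- of that column, the values `L ∘ δ` are its cofactors.
  functional≈dot : ∀ {m} (L : Vector m → Carrier) → (∀ {u v} → (∀ i → u i ≈ v i) → L u ≈ L v) →
                   (∀ u t v → L (λ i → u i + t * v i) ≈ L u + t * L v) →
                   ∀ v → L v ≈ dot v (L ∘ δ)
  functional≈dot {zero} L L-cong L-linear v = begin
    -- In dimension 0 all vectors agree, so v may be replaced by v - v, and linearity gives L v = L
    -- v - L v.
    L v                            ≈⟨ L-cong (λ ()) ⟩
    L (λ i → v i + - 1# * v i)     ≈⟨ L-linear v (- 1#) v ⟩
    L v + - 1# * L v               ≈⟨ solve 1 (λ x → x :+ (:- con (1 , 0)) :* x := con (0 , 0)) refl (L v) ⟩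
    0#                             ∎
  functional≈dot {suc m} L L-cong L-linear v = begin
    L v                                          ≈⟨ L-cong (λ { zero → solve 1 (λ x → x := con (0 , 0) :+ x :* con (1 , 0)) refl (v zero)
                                                              ; (suc i) → solve 2 (λ x y → x := x :+ y :* con (0 , 0)) refl (v (suc i)) (v zero) }) ⟩
    L (λ i → (0∷ (v ∘ suc)) i + v zero * δ zero i)   ≈⟨ L-linear (0∷ (v ∘ suc)) (v zero) (δ zero) ⟩
    L (0∷ (v ∘ suc)) + v zero * L (δ zero)       ≈⟨ +-comm _ _ ⟩
    v zero * L (δ zero) + L (0∷ (v ∘ suc))       ≈⟨ +-congˡ (functional≈dot (L ∘ 0∷_) (L-cong ∘ 0∷-cong)
                                                      (λ u t w → trans (L-cong (λ { zero → solve 1 (λ t → con (0 , 0) := con (0 , 0) :+ t :* con (0 , 0)) refl t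
                                                                                  ; (suc i) → refl })) (L-linear (0∷ u) t (0∷ w))) (v ∘ suc)) ⟩
    v zero * L (δ zero) + dot (v ∘ suc) (λ i → L (0∷ (δ i)))
      ≈⟨ +-congˡ (dot-cong {u = v ∘ suc} (λ _ → refl) (λ i → L-cong {0∷ (δ i)} {δ (suc i)} (λ { zero → refl ; (suc j) → refl }))) ⟩
    v zero * L (δ zero) + dot (v ∘ suc) (λ i → L (δ (suc i))) ∎
    where
    0∷_ : Vector m → Vector (suc m)
    (0∷ u) zero    = 0#
    (0∷ u) (suc i) = u i
    0∷-cong : ∀ {u w : Vector m} → (∀ i → u i ≈ w i) → ∀ i → (0∷ u) i ≈ (0∷ w) i
    0∷-cong e zero    = refl
    0∷-cong e (suc i) = e i

  -- Polynomial functions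

  -- Poly d f: f is a polynomial function of degree less than d, witnessed by its divided differences.
  data Poly : ℕ → (Carrier → Carrier) → Set (c ⊔ ℓ) where
    vanishing : ∀ {f} → (∀ x → f x ≈ 0#) → Poly zero f
    divided   : ∀ {d f} (g : Carrier → Carrier → Carrier) → (∀ r → Poly d (g r)) →
                (∀ r x → f x ≈ f r + (x - r) * g r x) → Poly (suc d) f

  Poly-cong : ∀ {d f g} → (∀ x → f x ≈ g x) → Poly d f → Poly d g
  Poly-cong e (vanishing z)   = vanishing λ x → trans (sym (e x)) (z x)
  Poly-cong e (divided q p d) = divided q p λ r x → trans (sym (e x)) (trans (d r x) (+-congʳ (e r)))

  Poly-linear : ∀ {d f g} t → Poly d f → Poly d g → Poly d (λ x → f x + t * g x)
  Poly-linear t (vanishing z) (vanishing z') = vanishing λ x →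
    trans (+-cong (z x) (*-congˡ (z' x))) (trans (+-identityˡ _) (zeroʳ t))
  Poly-linear {f = f} {g} t (divided q p d) (divided q' p' d') =
    divided (λ r x → q r x + t * q' r x) (λ r → Poly-linear t (p r) (p' r)) λ r x →
      trans (+-cong (d r x) (*-congˡ (d' r x)))
        (solve 6 (λ fr y q t gr q' → fr :+ y :* q :+ t :* (gr :+ y :* q') := fr :+ t :* gr :+ y :* (q :+ t :* q'))
          refl (f r) (x - r) (q r x) t (g r) (q' r x))

  Poly-zero : ∀ d → Poly d (λ _ → 0#)
  Poly-zero zero    = vanishing λ _ → refl
  Poly-zero (suc d) = divided (λ _ _ → 0#) (λ _ → Poly-zero d) λ r x → sym (trans (+-identityˡ _) (zeroʳ (x - r)))

  Poly-const : ∀ {d} t → Poly (suc d) (λ _ → t)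
  Poly-const {d} t = divided (λ _ _ → 0#) (λ _ → Poly-zero d) λ r x → sym (trans (+-congˡ (zeroʳ (x - r))) (+-identityʳ t))

  Poly-weaken : ∀ {d f} → Poly d f → Poly (suc d) f
  Poly-weaken (vanishing z)   = Poly-cong (sym ∘ z) (Poly-zero 1)
  Poly-weaken (divided q p d) = divided q (Poly-weaken ∘ p) d

  Poly-weakenᵏ : ∀ k {d f} → Poly d f → Poly (k ℕ.+ d) f
  Poly-weakenᵏ zero    p = p
  Poly-weakenᵏ (suc k) p = Poly-weaken (Poly-weakenᵏ k p)

  Poly-scale : ∀ {d f} t → Poly d f → Poly d (λ x → t * f x)
  Poly-scale {d} t p = Poly-cong (λ x → +-identityˡ _) (Poly-linear t (Poly-zero d) p)

  -- Affine factors suffice for determinants with affine entries and for the recursion of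
  -- `newtonQuotient`. The divided difference is the product rule, with f taken at r and the affine
  -- factor at x.
  Poly-* : ∀ {d f} a b → Poly d f → Poly (suc d) (λ x → (a + b * x) * f x)
  Poly-* a b (vanishing z) = Poly-cong (λ x → sym (trans (*-congˡ (z x)) (zeroʳ _))) (Poly-zero 1)
  Poly-* {f = f} a b (divided q p d) =
    divided (λ r x → b * f r + 1# * ((a + b * x) * q r x)) (λ r → Poly-linear 1# (Poly-const (b * f r)) (Poly-* a b (p r))) λ r x →
      trans (*-congˡ (d r x))
        (solve 6 (λ a b x r fr q → (a :+ b :* x) :* (fr :+ (x :- r) :* q) :=
                    (a :+ b :* r) :* fr :+ (x :- r) :* (b :* fr :+ con (1 , 0) :* ((a :+ b :* x) :* q)))
          refl a b x r (f r) (q r x))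

  Poly-Σ : ∀ {d k} (f : Carrier → Fin k → Carrier) → (∀ i → Poly d (λ x → f x i)) → Poly d (λ x → Σ[ f x ])
  Poly-Σ {d} {zero}  f p = Poly-zero d
  Poly-Σ {d} {suc k} f p = Poly-cong (λ x → +-congˡ (*-identityˡ _)) (Poly-linear 1# (p zero) (Poly-Σ (λ x → f x ∘ suc) (p ∘ suc)))

  Poly-det : ∀ {m} (M : Carrier → Mat m) (α β : Mat m) → (∀ x i j → M x i j ≈ α i j + β i j * x) → Poly (suc m) (λ x → det (M x))
  Poly-det {zero}  M α β e = Poly-const 1#
  Poly-det {suc m} M α β e = Poly-Σ (λ x → laplaceTerm (M x)) λ j → Poly-scale (sgn (toℕ j))
    (Poly-cong (λ x → *-congʳ (sym (e x zero j)))
      (Poly-* (α zero j) (β zero j) (Poly-det (λ x → minor (M x) j) (minor α j) (minor β j) (λ x r s → e x (suc r) (punchIn j s)))))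

  ⟦+⟧ : ∀ k l → ⟦ k ℕ.+ l ⟧ ≈ ⟦ k ⟧ + ⟦ l ⟧
  ⟦+⟧ zero    l = sym (+-identityˡ _)
  ⟦+⟧ (suc k) l = trans (+-congˡ (⟦+⟧ k l)) (sym (+-assoc _ _ _))

  ⟦⟧-apart : ∀ {k l} → k ℕ.< l → ¬ (⟦ l ⟧ - ⟦ k ⟧ ≈ 0#)
  ⟦⟧-apart {k} {l} k<l e = contradiction (char-zero (l ℕ.∸ k) (begin
    ⟦ l ℕ.∸ k ⟧                      ≈⟨ solve 2 (λ x y → x := x :+ y :- y) refl ⟦ l ℕ.∸ k ⟧ ⟦ k ⟧ ⟩
    ⟦ l ℕ.∸ k ⟧ + ⟦ k ⟧ - ⟦ k ⟧      ≈⟨ +-congʳ (⟦+⟧ (l ℕ.∸ k) k) ⟨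
    ⟦ l ℕ.∸ k ℕ.+ k ⟧ - ⟦ k ⟧        ≡⟨ cong (λ x → ⟦ x ⟧ - ⟦ k ⟧) (ℕₚ.m∸n+n≡m (ℕₚ.<⇒≤ k<l)) ⟩
    ⟦ l ⟧ - ⟦ k ⟧                    ≈⟨ e ⟩
    0#                               ∎)) (ℕₚ.m>n⇒m∸n≢0 k<l)

  -- C(x)(x - A) = F forces C = 0 and F = 0 by comparing degrees: dividing C(x) - C(r) by x - r
  -- yields an equation of the same shape for a polynomial of smaller degree.
  Poly-kernel : ∀ {n} (A : Mat n) d N (C : Carrier → Vector n) (F : Vector n) → (∀ k → Poly d (λ x → C x k)) →
                (∀ m → N ℕ.≤ m → ∀ k → ⟦ m ⟧ * C ⟦ m ⟧ k - (A ⊛ C ⟦ m ⟧) k ≈ F k) →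
                (∀ x k → C x k ≈ 0#) ×ₜ (∀ k → F k ≈ 0#)
  Poly-kernel {n} A zero N C F p e = C≈0 , λ k → trans (sym (e N ℕₚ.≤-refl k)) (begin
      ⟦ N ⟧ * C ⟦ N ⟧ k - (A ⊛ C ⟦ N ⟧) k   ≈⟨ +-cong (*-congˡ (C≈0 ⟦ N ⟧ k)) (-‿cong (dot-zeroʳ (A k) (C ⟦ N ⟧) (C≈0 ⟦ N ⟧))) ⟩
      ⟦ N ⟧ * 0# - 0#                       ≈⟨ solve 1 (λ x → x :* con (0 , 0) :- con (0 , 0) := con (0 , 0)) refl ⟦ N ⟧ ⟩
      0#                                    ∎)
    where
    C≈0 : ∀ x k → C x k ≈ 0#
    C≈0 x k with vanishing z ← p k = z x
  Poly-kernel {n} A (suc d) N C F p e = C≈0 , λ k → trans (sym (e N ℕₚ.≤-refl k)) (begin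
      r * C r k - (A ⊛ C r) k   ≈⟨ +-cong (*-congˡ (C≈0 r k)) (-‿cong (dot-zeroʳ (A k) (C r) (C≈0 r))) ⟩
      r * 0# - 0#               ≈⟨ solve 1 (λ x → x :* con (0 , 0) :- con (0 , 0) := con (0 , 0)) refl r ⟩
      0#                        ∎)
    where
    r = ⟦ N ⟧
    quotient : ∀ {f} → Poly (suc d) f → Σ (Carrier → Carrier) λ g → Poly d g ×ₜ (∀ x → f x ≈ f r + (x - r) * g x)
    quotient (divided g q e) = g r , q r , e r
    E : Carrier → Vector n
    E x k = proj₁ (quotient (p k)) x
    C≈ : ∀ x k → C x k ≈ C r k + (x - r) * E x k
    C≈ x k = proj₂ (proj₂ (quotient (p k))) x
    -- The right side F is the same at x and at r, so the difference of the two equations is (x - r)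
    -- (x E - A E + C r) = 0; thus - C r is the new constant.
    E-equation : ∀ m → suc N ℕ.≤ m → ∀ k → ⟦ m ⟧ * E ⟦ m ⟧ k - (A ⊛ E ⟦ m ⟧) k ≈ - C r k
    E-equation m N<m k = x∙y⁻¹≈ε⇒x≈y _ _ (*-cancel-zero (⟦⟧-apart N<m) (begin
      (x - r) * (x * E x k - AE - - C r k)
        ≈⟨ solve 6 (λ x r e ae c ac → (x :- r) :* (x :* e :- ae :- :- c) :=
             x :* (c :+ (x :- r) :* e) :- (ac :+ (x :- r) :* ae) :- (r :* c :- ac)) refl x r (E x k) AE (C r k) AC ⟩
      x * (C r k + (x - r) * E x k) - (AC + (x - r) * AE) - (r * C r k - AC)
        ≈⟨ +-congʳ (+-cong (*-congˡ (C≈ x k)) (-‿cong (trans (dot-cong {u = A k} (λ _ → refl) (C≈ x)) (dot-linearʳ (A k) (C r) (x - r) (E x))))) ⟨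
      x * C x k - (A ⊛ C x) k - (r * C r k - AC)
        ≈⟨ +-cong (e m (ℕₚ.<⇒≤ N<m) k) (-‿cong (e N ℕₚ.≤-refl k)) ⟩
      F k - F k
        ≈⟨ -‿inverseʳ _ ⟩
      0# ∎))
      where
      x = ⟦ m ⟧
      AE = (A ⊛ E x) k
      AC = (A ⊛ C r) k
    IH : (∀ x k → E x k ≈ 0#) ×ₜ (∀ k → - C r k ≈ 0#)
    IH = Poly-kernel A d (suc N) E (λ k → - C r k) (λ k → proj₁ (proj₂ (quotient (p k)))) E-equation
    C≈0 : ∀ x k → C x k ≈ 0#
    C≈0 x k = begin
      C x k                              ≈⟨ C≈ x k ⟩
      C r k + (x - r) * E x k            ≈⟨ solve 3 (λ c y e → c :+ y :* e := :- :- c :+ y :* e) refl (C r k) (x - r) (E x k) ⟩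
      - - C r k + (x - r) * E x k        ≈⟨ +-cong (-‿cong (proj₂ IH k)) (*-congˡ (proj₁ IH x k)) ⟩
      - 0# + (x - r) * 0#                ≈⟨ solve 1 (λ y → :- con (0 , 0) :+ y :* con (0 , 0) := con (0 , 0)) refl (x - r) ⟩
      0#                                 ∎

  replaceColumn-cong : ∀ {m} (A : Mat m) p {u v : Vector m} → (∀ i → u i ≈ v i) → ∀ i j → replaceColumn A p u i j ≈ replaceColumn A p v i j
  replaceColumn-cong A p e i j with j Fin.≟ p
  ... | yes _ = e i
  ... | no  _ = refl

  dot-xδ-u : ∀ {m} x (k : Fin m) (u a : Vector m) → dot (λ i → x * δ k i - u i) a ≈ x * a k - dot u a
  dot-xδ-u x k u a = begin
    dot (λ i → x * δ k i - u i) a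
      ≈⟨ dot-cong {v = a} (λ i → solve 2 (λ d u → d :- u := (con (0 , 0) :+ d) :+ (:- con (1 , 0)) :* u) refl (x * δ k i) (u i)) (λ _ → refl) ⟩
    dot (λ i → (0# + x * δ k i) + - 1# * u i) a
      ≈⟨ dot-linearˡ (λ i → 0# + x * δ k i) (- 1#) u a ⟩
    dot (λ i → 0# + x * δ k i) a + - 1# * dot u a
      ≈⟨ +-congʳ (trans (dot-linearˡ (λ _ → 0#) x (δ k) a) (+-cong (dot-zeroˡ (λ _ → 0#) a (λ _ → refl)) (*-congˡ (dot-δ k a)))) ⟩
    0# + x * a k + - 1# * dot u a
      ≈⟨ solve 2 (λ y z → con (0 , 0) :+ y :+ (:- con (1 , 0)) :* z := y :- z) refl (x * a k) (dot u a) ⟩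
    x * a k - dot u a ∎

  -- Newton bases and the quotient by x - A

  newtonStep : ∀ {m} → Mat m → Carrier → Vector m → Vector m
  newtonStep A t v i = (A ⊛ v) i - t * v i

  -- The vectors ∏_{j<k} (A - μ j) v, the matrix counterpart of Newton's interpolation basis. Row
  -- vectors are handled by passing to `A ᵀ`.
  newton : ∀ {m} → Mat m → (ℕ → Carrier) → Vector m → ℕ → Vector m
  newton A μ v zero    = v
  newton A μ v (suc k) = newtonStep A (μ k) (newton A μ v k)

  newtonStep-zero : ∀ {m} (A : Mat m) t {v : Vector m} → (∀ i → v i ≈ 0#) → ∀ i → newtonStep A t v i ≈ 0#
  newtonStep-zero A t {v} z i = begin
    (A ⊛ v) i - t * v i  ≈⟨ +-cong (dot-zeroʳ (A i) v z) (-‿cong (*-congˡ (z i))) ⟩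
    0# - t * 0#          ≈⟨ solve 1 (λ t → con (0 , 0) :- t :* con (0 , 0) := con (0 , 0)) refl t ⟩
    0#                   ∎

  dot-newtonStepʳ : ∀ {m} (A : Mat m) t u v → dot u (newtonStep A t v) ≈ dot u (A ⊛ v) - t * dot u v
  dot-newtonStepʳ A t u v = begin
    dot u (λ i → (A ⊛ v) i - t * v i)        ≈⟨ dot-cong {u = u} (λ _ → refl) (λ i → solve 3 (λ a t v → a :- t :* v := a :+ (:- t) :* v) refl ((A ⊛ v) i) t (v i)) ⟩
    dot u (λ i → (A ⊛ v) i + (- t) * v i)    ≈⟨ dot-linearʳ u (A ⊛ v) (- t) v ⟩
    dot u (A ⊛ v) + (- t) * dot u v          ≈⟨ solve 3 (λ a t v → a :+ (:- t) :* v := a :- t :* v) refl (dot u (A ⊛ v)) t (dot u v) ⟩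
    dot u (A ⊛ v) - t * dot u v              ∎

  dot-newtonStepˡ : ∀ {m} (A : Mat m) t u v → dot (newtonStep (A ᵀ) t u) v ≈ dot u (A ⊛ v) - t * dot u v
  dot-newtonStepˡ A t u v = begin
    dot (newtonStep (A ᵀ) t u) v           ≈⟨ dot-comm (newtonStep (A ᵀ) t u) v ⟩
    dot v (newtonStep (A ᵀ) t u)           ≈⟨ dot-newtonStepʳ (A ᵀ) t v u ⟩
    dot v ((A ᵀ) ⊛ u) - t * dot v u        ≈⟨ +-cong (trans (dot-comm v _) (dot-adjoint A u v)) (-‿cong (*-congˡ (dot-comm v u))) ⟩
    dot u (A ⊛ v) - t * dot u v            ∎

  rootProduct : (ℕ → Carrier) → ℕ → Carrier → Carrier
  rootProduct μ m x = Π[ (λ (i : Fin m) → x - μ (toℕ i)) ]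

  rootProduct-suc : ∀ μ m x → rootProduct μ (suc m) x ≈ rootProduct μ m x * (x - μ m)
  rootProduct-suc μ m x = trans (Π-last (λ (i : Fin (suc m)) → x - μ (toℕ i)))
    (*-cong (Π-cong {m} λ i → reflexive (cong (λ k → x - μ k) (Finₚ.toℕ-inject₁ i))) (reflexive (cong (λ k → x - μ k) (Finₚ.toℕ-fromℕ m))))

  rootProduct-root : ∀ μ {i m} → i ℕ.< m → rootProduct μ m (μ i) ≈ 0#
  rootProduct-root μ {i} {suc m} i<1+m with i ℕ.≟ m
  ... | yes ≡.refl = trans (rootProduct-suc μ m (μ i)) (trans (*-congˡ (-‿inverseʳ (μ i))) (zeroʳ _))
  ... | no i≢m = trans (rootProduct-suc μ m (μ i)) (trans (*-congʳ (rootProduct-root μ (ℕₚ.≤∧≢⇒< (ℕ.s≤s⁻¹ i<1+m) i≢m))) (zeroˡ _))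

  -- With s = newton A μ v and f = rootProduct μ m, this is (f(x) v - f(A) v) / (x - A), where f(A) v = s m.
  newtonQuotient : ∀ {n} → Mat n → (ℕ → Carrier) → Vector n → ℕ → Carrier → Vector n
  newtonQuotient A μ v zero    x i = 0#
  newtonQuotient A μ v (suc m) x i = newton A μ v m i + (- μ m + 1# * x) * newtonQuotient A μ v m x i

  module _ {n} (A : Mat n) (μ : ℕ → Carrier) (v : Vector n) where
    private
      s : ℕ → Vector n
      s = newton A μ v
      G : ℕ → Carrier → Vector n
      G = newtonQuotient A μ v

    -- The linear factor of `newtonQuotient` is written `- μ m + 1# * x` to fit `Poly-*` as it
    -- stands.
    newtonQuotient-Poly : ∀ m k → Poly m (λ x → newtonQuotient A μ v m x k)
    newtonQuotient-Poly zero    k = vanishing λ _ → refl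
    newtonQuotient-Poly (suc m) k = Poly-cong (λ x → +-congˡ (*-identityˡ _))
      (Poly-linear 1# (Poly-const (s m k)) (Poly-* (- μ m) 1# (newtonQuotient-Poly m k)))

    newtonQuotient-equation : ∀ m x k → x * G m x k - (A ⊛ G m x) k ≈ rootProduct μ m x * v k - s m k
    newtonQuotient-equation zero x k = begin
      x * 0# - (A ⊛ (λ _ → 0#)) k   ≈⟨ +-congˡ (-‿cong (dot-zeroʳ (A k) (λ _ → 0#) (λ _ → refl))) ⟩
      x * 0# - 0#                   ≈⟨ solve 2 (λ x v → x :* con (0 , 0) :- con (0 , 0) := con (1 , 0) :* v :- v) refl x (v k) ⟩
      1# * v k - v k                ∎
    newtonQuotient-equation (suc m) x k = begin
      x * (s m k + y * G m x k) - (A ⊛ G (suc m) x) k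
        ≈⟨ +-congˡ (-‿cong (dot-linearʳ (A k) (s m) y (G m x))) ⟩
      x * (s m k + y * G m x k) - (As + y * AG)
        ≈⟨ solve 6 (λ x t s as g ag → x :* (s :+ (:- t :+ con (1 , 0) :* x) :* g) :- (as :+ (:- t :+ con (1 , 0) :* x) :* ag)
             := (x :- t) :* (x :* g :- ag) :+ x :* s :- as) refl x (μ m) (s m k) As (G m x k) AG ⟩
      (x - μ m) * (x * G m x k - AG) + x * s m k - As
        ≈⟨ +-congʳ (+-congʳ (*-congˡ (newtonQuotient-equation m x k))) ⟩
      (x - μ m) * (rootProduct μ m x * v k - s m k) + x * s m k - As
        ≈⟨ solve 6 (λ x t f v s as → (x :- t) :* (f :* v :- s) :+ x :* s :- as := f :* (x :- t) :* v :- (as :- t :* s))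
             refl x (μ m) (rootProduct μ m x) (v k) (s m k) As ⟩
      rootProduct μ m x * (x - μ m) * v k - s (suc m) k
        ≈⟨ +-congʳ (*-congʳ (rootProduct-suc μ m x)) ⟨
      rootProduct μ (suc m) x * v k - s (suc m) k ∎
      where
      y = - μ m + 1# * x
      As = (A ⊛ s m) k
      AG = (A ⊛ G m x) k

    -- With `newtonQuotient-next` this shows what the quotient is at a root: it starts from s i, the
    -- product over k < i, skips the factor of i, and gains A - μ m for each later m. So `G n (μ i)`
    -- is ∏_{k≠i} (A - μ k) v, whether or not the roots are distinct.
    newtonQuotient-first : ∀ i k → G (suc i) (μ i) k ≈ s i k
    newtonQuotient-first i k = solve 3 (λ s t g → s :+ (:- t :+ con (1 , 0) :* t) :* g := s) refl (s i k) (μ i) (G i (μ i) k)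

    -- Once the root product vanishes at x = μ i, the equation of the quotient reads (x - A) G = - s
    -- m, and this turns s m + (x - μ m) G into (A - μ m) G.
    newtonQuotient-next : ∀ {i m} → i ℕ.< m → ∀ k → G (suc m) (μ i) k ≈ newtonStep A (μ m) (G m (μ i)) k
    newtonQuotient-next {i} {m} i<m k = begin
      s m k + (- μ m + 1# * x) * g
        ≈⟨ solve 5 (λ s t x g v → s :+ (:- t :+ con (1 , 0) :* x) :* g := x :* g :- (con (0 , 0) :* v :- s) :- t :* g) refl (s m k) (μ m) x g (v k) ⟩
      x * g - (0# * v k - s m k) - μ m * g
        ≈⟨ +-congʳ (+-congˡ (-‿cong (trans (newtonQuotient-equation m x k) (+-congʳ (*-congʳ (rootProduct-root μ i<m)))))) ⟨
      x * g - (x * g - Ag) - μ m * g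
        ≈⟨ solve 3 (λ y a z → y :- (y :- a) :- z := a :- z) refl (x * g) Ag (μ m * g) ⟩
      Ag - μ m * g ∎
      where
      x = μ i
      g = G m x k
      Ag = (A ⊛ G m x) k

  -- Cofactors of x - τ and the antitriangular pairing

  module Resolvent {n} (τ : Mat (suc n)) where
    last : Fin (suc n)
    last = fromℕ n

    inject₁≢last : ∀ (i : Fin n) → inject₁ i ≢ last
    inject₁≢last i e = Finₚ.fromℕ≢inject₁ (≡.sym e)

    A : Mat n
    A = block τ

    col row : Vector n
    col i = τ (inject₁ i) last
    row j = τ last (inject₁ j)

    x-τ : Carrier → Mat (suc n)
    x-τ x = scal x ⊖ τ

    L : Carrier → Vector (suc n) → Carrier
    L x v = det (replaceColumn (x-τ x) last v)

    -- The cofactors of the last column of x - τ.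
    cofactors : Carrier → Vector (suc n)
    cofactors x k = L x (δ k)

    a : Carrier → Vector n
    a x = cofactors x ∘ inject₁

    L≈dot : ∀ x v → L x v ≈ dot v (cofactors x)
    L≈dot x = functional≈dot (L x) (λ e → det-cong (replaceColumn-cong (x-τ x) last e)) λ u t v →
      det-linear last t {A = replaceColumn (x-τ x) last u} {B = replaceColumn (x-τ x) last v}
        {C = replaceColumn (x-τ x) last (λ i → u i + t * v i)}
        (λ i j ≢ → trans (replaceColumn-off (x-τ x) last _ i j ≢) (sym (replaceColumn-off (x-τ x) last u i j ≢)))
        (λ i j ≢ → trans (replaceColumn-off (x-τ x) last v i j ≢) (sym (replaceColumn-off (x-τ x) last u i j ≢)))
        (λ i → trans (replaceColumn-at (x-τ x) last _ i)
          (+-cong (sym (replaceColumn-at (x-τ x) last u i)) (*-congˡ (sym (replaceColumn-at (x-τ x) last v i)))))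

    x-τ-block : ∀ x i j → x-τ x (inject₁ i) (inject₁ j) ≈ x * δ i j - A i j
    x-τ-block x i j = +-congʳ (trans (scal≈δ x (inject₁ i) (inject₁ j)) (*-congˡ (reflexive (δ-inject₁ i j))))

    x-τ-row : ∀ x j → x-τ x last (inject₁ j) ≈ - row j
    x-τ-row x j = trans (+-congʳ (trans (scal≈δ x last (inject₁ j)) (trans (*-congˡ (reflexive (δ-fromℕ-inject₁ j))) (zeroʳ x)))) (+-identityˡ _)

    x-τ-col : ∀ x i → x-τ x (inject₁ i) last ≈ - col i
    x-τ-col x i = trans (+-congʳ (trans (scal≈δ x (inject₁ i) last) (trans (*-congˡ (reflexive (≡.trans (δ-sym (inject₁ i) last) (δ-fromℕ-inject₁ i)))) (zeroʳ x)))) (+-identityˡ _)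

    x-τ-corner : ∀ x → x-τ x last last ≈ x - τ last last
    x-τ-corner x = +-congʳ (trans (scal≈δ x last last) (trans (*-congˡ (reflexive (δ-diagonal last))) (*-identityʳ x)))

    cofactors-last : ∀ x → cofactors x last ≈ det (scal x ⊖ A)
    cofactors-last x = begin
      det B                           ≈⟨ det-last-column B (λ i → trans (replaceColumn-at (x-τ x) last (δ last) (inject₁ i)) (reflexive (δ-fromℕ-inject₁ i))) ⟩
      B last last * det (block B)     ≈⟨ *-cong (trans (replaceColumn-at (x-τ x) last (δ last) last) (reflexive (δ-diagonal last)))
                                          (det-cong {A = block B} {B = scal x ⊖ A} λ i j → trans (replaceColumn-off (x-τ x) last (δ last) (inject₁ i) (inject₁ j) (inject₁≢last j))
                                            (trans (x-τ-block x i j) (+-congʳ (sym (scal≈δ x i j))))) ⟩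
      1# * det (scal x ⊖ A)           ≈⟨ *-identityˡ _ ⟩
      det (scal x ⊖ A)                ∎
      where
      B = replaceColumn (x-τ x) last (δ last)

    -- Pairing the cofactors of the last column with column k evaluates a determinant with two equal
    -- columns, hence gives 0; its last summand is moved to the right. Thus `a x` plays the part of
    -- row times the adjugate of x - A, with no adjugate matrix constructed.
    resolvent-equation : ∀ x k → x * a x k - ((A ᵀ) ⊛ a x) k ≈ cofactors x last * row k
    resolvent-equation x k = begin
      x * a x k - ((A ᵀ) ⊛ a x) k
        ≈⟨ dot-xδ-u x k ((A ᵀ) k) (a x) ⟨
      dot (λ i → x * δ k i - A i k) (a x)
        ≈⟨ dot-cong {v = a x} (λ i → trans (+-congʳ (*-congˡ (reflexive (δ-sym k i)))) (sym (x-τ-block x i k))) (λ _ → refl) ⟩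
      D
        ≈⟨ solve 3 (λ d α c → d := d :+ (:- c) :* α :+ α :* c) refl D (cofactors x last) (row k) ⟩
      D + - row k * cofactors x last + cofactors x last * row k
        ≈⟨ +-congʳ (trans (+-congˡ (*-congʳ (sym (x-τ-row x k)))) (sym (Σ-last (λ i → x-τ x i (inject₁ k) * cofactors x i)))) ⟩
      dot (λ i → x-τ x i (inject₁ k)) (cofactors x) + cofactors x last * row k
        ≈⟨ +-congʳ (L≈dot x (λ i → x-τ x i (inject₁ k))) ⟨
      det B + cofactors x last * row k
        ≈⟨ +-congʳ (det-equal-columns B (inject₁ k) last (inject₁≢last k) λ i →
             trans (replaceColumn-off (x-τ x) last _ i (inject₁ k) (inject₁≢last k)) (sym (replaceColumn-at (x-τ x) last (λ i → x-τ x i (inject₁ k)) i))) ⟩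
      0# + cofactors x last * row k
        ≈⟨ +-identityˡ _ ⟩
      cofactors x last * row k ∎
      where
      D = dot (λ i → x-τ x (inject₁ i) (inject₁ k)) (a x)
      B = replaceColumn (x-τ x) last (λ i → x-τ x i (inject₁ k))

    -- Expansion along the last column; the same cofactors that obey `resolvent-equation` are paired
    -- with `col`.
    det-x-τ : ∀ x → det (scal x ⊖ τ) ≈ (x - τ last last) * cofactors x last - dot (a x) col
    det-x-τ x = begin
      det (x-τ x)
        ≈⟨ det-cong same ⟩
      L x (λ i → x-τ x i last)
        ≈⟨ L≈dot x (λ i → x-τ x i last) ⟩
      dot (λ i → x-τ x i last) (cofactors x)
        ≈⟨ Σ-last (λ i → x-τ x i last * cofactors x i) ⟩
      dot (λ i → x-τ x (inject₁ i) last) (a x) + x-τ x last last * cofactors x last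
        ≈⟨ +-cong (dot-cong {v = a x} (λ i → trans (x-τ-col x i) (solve 1 (λ c → :- c := con (0 , 0) :+ (:- con (1 , 0)) :* c) refl (col i))) (λ _ → refl)) (*-congʳ (x-τ-corner x)) ⟩
      dot (λ i → 0# + - 1# * col i) (a x) + (x - τ last last) * cofactors x last
        ≈⟨ +-congʳ (trans (dot-linearˡ (λ _ → 0#) (- 1#) col (a x)) (+-cong (dot-zeroˡ (λ _ → 0#) (a x) (λ _ → refl)) (*-congˡ (dot-comm col (a x))))) ⟩
      0# + - 1# * dot (a x) col + (x - τ last last) * cofactors x last
        ≈⟨ solve 2 (λ d e → con (0 , 0) :+ (:- con (1 , 0)) :* d :+ e := e :- d) refl (dot (a x) col) ((x - τ last last) * cofactors x last) ⟩
      (x - τ last last) * cofactors x last - dot (a x) col ∎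
      where
      same : ∀ i j → x-τ x i j ≈ replaceColumn (x-τ x) last (λ i → x-τ x i last) i j
      same i j with j Fin.≟ last
      ... | yes ≡.refl = refl
      ... | no _ = refl

    cofactors-Poly : ∀ k → Poly (suc (suc n)) (λ x → cofactors x k)
    cofactors-Poly k = Poly-det (λ x → replaceColumn (x-τ x) last (δ k))
      (replaceColumn (λ i j → - τ i j) last (δ k)) (replaceColumn δ last (λ _ → 0#)) entry
      where
      entry : ∀ x i j → replaceColumn (x-τ x) last (δ k) i j ≈
              replaceColumn (λ i j → - τ i j) last (δ k) i j + replaceColumn δ last (λ _ → 0#) i j * x
      entry x i j with j Fin.≟ last
      ... | yes _ = sym (trans (+-congˡ (zeroˡ x)) (+-identityʳ _))
      ... | no _ = trans (+-congʳ (scal≈δ x i j)) (solve 3 (λ x d t → x :* d :- t := :- t :+ d :* x) refl x (δ i j) (τ i j))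

    -- Using the roots in opposite orders on the two sides makes the pairing antitriangular.
    reversed : (ℕ → Carrier) → ℕ → Carrier
    reversed μ j = μ (n ℕ.∸ suc j)

    pairing : (ℕ → Carrier) → ℕ → ℕ → Carrier
    pairing μ i j = dot (newton (A ᵀ) μ row i) (newton A (reversed μ) col j)

    module _ (μ : ℕ → Carrier) (charpoly : ∀ x → det (scal x ⊖ A) ≈ rootProduct μ n x) where
      private
        s : ℕ → Vector n
        s = newton (A ᵀ) μ row
        G : ℕ → Carrier → Vector n
        G = newtonQuotient (A ᵀ) μ row
        ν : ℕ → Carrier
        ν = reversed μ
        M : ℕ → ℕ → Carrier
        M = pairing μ

      -- a(x) and G(x) both solve C(x)(x - A) = f(x) row, up to the constant s n = row f(A).
      a-G : (∀ x k → a x k + - 1# * G n x k ≈ 0#) ×ₜ (∀ k → s n k ≈ 0#)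
      -- The bound 2 + n comes from determinants of size n + 1 with affine entries, and the quotient
      -- is weakened by 2 to meet it. The equation holds at every x, so N starts at 0.
      a-G = Poly-kernel (A ᵀ) (2 ℕ.+ n) 0 (λ x k → a x k + - 1# * G n x k) (s n)
        (λ k → Poly-linear (- 1#) (cofactors-Poly (inject₁ k)) (Poly-weakenᵏ 2 (newtonQuotient-Poly (A ᵀ) μ row n k)))
        (λ m _ k → equation ⟦ m ⟧ k)
        where
        equation : ∀ x k → x * (a x k + - 1# * G n x k) - ((A ᵀ) ⊛ (λ k → a x k + - 1# * G n x k)) k ≈ s n k
        equation x k = begin
          x * (a x k + - 1# * G n x k) - ((A ᵀ) ⊛ (λ k → a x k + - 1# * G n x k)) k
            ≈⟨ +-congˡ (-‿cong (dot-linearʳ ((A ᵀ) k) (a x) (- 1#) (G n x))) ⟩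
          x * (a x k + - 1# * G n x k) - (Aa + - 1# * AG)
            ≈⟨ solve 5 (λ x a g aa ag → x :* (a :+ (:- con (1 , 0)) :* g) :- (aa :+ (:- con (1 , 0)) :* ag) := (x :* a :- aa) :- (x :* g :- ag))
                 refl x (a x k) (G n x k) Aa AG ⟩
          (x * a x k - Aa) - (x * G n x k - AG)
            ≈⟨ +-cong (trans (resolvent-equation x k) (*-congʳ (trans (cofactors-last x) (charpoly x)))) (-‿cong (newtonQuotient-equation (A ᵀ) μ row n x k)) ⟩
          rootProduct μ n x * row k - (rootProduct μ n x * row k - s n k)
            ≈⟨ solve 2 (λ p s → p :- (p :- s) := s) refl (rootProduct μ n x * row k) (s n k) ⟩
          s n k ∎
          where
          Aa = ((A ᵀ) ⊛ a x) k
          AG = ((A ᵀ) ⊛ G n x) k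

      -- The second half of `a-G` is Cayley-Hamilton applied to `row`; further factors keep the
      -- vector zero.
      newton-vanishes : ∀ {i} → n ℕ.≤ i → ∀ k → s i k ≈ 0#
      newton-vanishes {i} n≤i = subst (λ i → ∀ k → s i k ≈ 0#) (ℕₚ.m∸n+n≡m n≤i) (beyond (i ℕ.∸ n))
        where
        beyond : ∀ l k → s (l ℕ.+ n) k ≈ 0#
        beyond zero    = proj₂ a-G
        beyond (suc l) = newtonStep-zero (A ᵀ) (μ (l ℕ.+ n)) (beyond l)

      -- The corner cofactor is the characteristic polynomial of A and vanishes at its root. Since
      -- `a` and `G n` agree at every x, the roots themselves included, multiplicities cause no
      -- trouble.
      det-at-root : ∀ {i} → i ℕ.< n → det (scal (μ i) ⊖ τ) ≈ - dot (G n (μ i)) col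
      det-at-root {i} i<n = begin
        det (scal (μ i) ⊖ τ)
          ≈⟨ det-x-τ (μ i) ⟩
        (μ i - τ last last) * cofactors (μ i) last - dot (a (μ i)) col
          ≈⟨ +-cong (*-congˡ (trans (cofactors-last (μ i)) (trans (charpoly (μ i)) (rootProduct-root μ i<n))))
               (-‿cong (dot-cong {v = col} (λ k → trans (solve 2 (λ a g → a := (a :+ (:- con (1 , 0)) :* g) :+ g) refl (a (μ i) k) (G n (μ i) k))
                 (trans (+-congʳ (proj₁ a-G (μ i) k)) (+-identityˡ _))) (λ _ → refl))) ⟩
        (μ i - τ last last) * 0# - dot (G n (μ i)) col
          ≈⟨ solve 2 (λ y z → y :* con (0 , 0) :- z := :- z) refl (μ i - τ last last) (dot (G n (μ i)) col) ⟩
        - dot (G n (μ i)) col ∎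

      private
        ν≡μ : ∀ {i j} → suc (i ℕ.+ j) ≡ n → ν j ≡ μ i
        ν≡μ {i} {j} e = cong μ (≡.trans (cong (ℕ._∸ suc j) (≡.trans (≡.sym e) (≡.sym (ℕₚ.+-suc i j)))) (ℕₚ.m+n∸n≡m i (suc j)))

      -- A moves across the pairing, but the Newton steps on the two sides subtract different roots;
      -- the second summand corrects for this. It drops out when i + j + 1 = n, where the reversed
      -- order makes ν j = μ i.
      pairing-suc : ∀ i j → M i (suc j) ≈ M (suc i) j + (μ i - ν j) * M i j
      pairing-suc i j = begin
        dot (s i) (newtonStep A (ν j) y)            ≈⟨ dot-newtonStepʳ A (ν j) (s i) y ⟩
        dot (s i) (A ⊛ y) - ν j * dot (s i) y       ≈⟨ solve 4 (λ d n m p → d :- n :* p := (d :- m :* p) :+ (m :- n) :* p) refl (dot (s i) (A ⊛ y)) (ν j) (μ i) (dot (s i) y) ⟩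
        (dot (s i) (A ⊛ y) - μ i * dot (s i) y) + (μ i - ν j) * dot (s i) y   ≈⟨ +-congʳ (dot-newtonStepˡ A (μ i) (s i) y) ⟨
        M (suc i) j + (μ i - ν j) * M i j ∎
        where
        y = newton A ν col j

      -- Induction on j moves all factors to the row side, where `newton-vanishes` applies. The
      -- correction term vanishes through its coefficient on the line i + j + 1 = n and by induction
      -- beyond it.
      pairing-zero : ∀ i j → n ℕ.≤ i ℕ.+ j → M i j ≈ 0#
      pairing-zero i zero    n≤ = dot-zeroˡ (s i) col (newton-vanishes (subst (n ℕ.≤_) (ℕₚ.+-identityʳ i) n≤))
      pairing-zero i (suc j) n≤ = trans (pairing-suc i j)
        (trans (+-cong (pairing-zero (suc i) j n≤') product-zero) (+-identityˡ 0#))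
        where
        n≤' : n ℕ.≤ suc (i ℕ.+ j)
        n≤' = subst (n ℕ.≤_) (ℕₚ.+-suc i j) n≤
        product-zero : (μ i - ν j) * M i j ≈ 0#
        product-zero with n ℕ.≟ suc (i ℕ.+ j)
        ... | yes e = trans (*-congʳ (trans (+-congˡ (-‿cong (reflexive (ν≡μ (≡.sym e))))) (-‿inverseʳ (μ i)))) (zeroˡ _)
        ... | no n≢ = trans (*-congˡ (pairing-zero i j (ℕ.s≤s⁻¹ (ℕₚ.≤∧≢⇒< n≤' n≢)))) (zeroʳ _)

      -- On the column side stand exactly the factors A - μ m with m > i. `transfer` carries them
      -- over one by one in increasing order of m, which is the order in which `newtonQuotient-next`
      -- takes them up.
      pairing-antidiagonal : ∀ i j → suc (i ℕ.+ j) ≡ n → M i j ≈ dot (G n (μ i)) col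
      pairing-antidiagonal i j e = trans
        (dot-cong {v = newton A ν col j} (λ k → sym (newtonQuotient-first (A ᵀ) μ row i k)) (λ _ → refl))
        (transfer j (suc i) (ℕₚ.n<1+n i) e)
        where
        transfer : ∀ j m → i ℕ.< m → m ℕ.+ j ≡ n → dot (G m (μ i)) (newton A ν col j) ≈ dot (G n (μ i)) col
        transfer zero m i<m e = reflexive (cong (λ m → dot (G m (μ i)) col) (≡.trans (≡.sym (ℕₚ.+-identityʳ m)) e))
        transfer (suc j) m i<m e = begin
          dot g (newtonStep A (ν j) y)               ≈⟨ dot-newtonStepʳ A (ν j) g y ⟩
          dot g (A ⊛ y) - ν j * dot g y              ≈⟨ dot-newtonStepˡ A (ν j) g y ⟨
          dot (newtonStep (A ᵀ) (ν j) g) y           ≡⟨ cong (λ t → dot (newtonStep (A ᵀ) t g) y) (ν≡μ e') ⟩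
          dot (newtonStep (A ᵀ) (μ m) g) y           ≈⟨ dot-cong {v = y} (λ k → sym (newtonQuotient-next (A ᵀ) μ row i<m k)) (λ _ → refl) ⟩
          dot (G (suc m) (μ i)) y                    ≈⟨ transfer j (suc m) (ℕₚ.m<n⇒m<1+n i<m) e' ⟩
          dot (G n (μ i)) col                        ∎
          where
          g = G m (μ i)
          y = newton A ν col j
          e' : suc (m ℕ.+ j) ≡ n
          e' = ≡.trans (≡.sym (ℕₚ.+-suc m j)) e

      det-pairing : det {n} (λ i j → M (toℕ i) (toℕ j)) ≈
                    sgn ((n ℕ.* (n ℕ.∸ 1)) / 2) * Π[ (λ (i : Fin n) → dot (G n (μ (toℕ i))) col) ]
      det-pairing = det-antitriangular n M (λ i → dot (G n (μ i)) col) pairing-zero pairing-antidiagonal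

  -- The entries of D

  ·-⊛ : ∀ {m} (A B : Mat m) v i → ((A · B) ⊛ v) i ≈ (A ⊛ (B ⊛ v)) i
  ·-⊛ A B v i = begin
    Σ[ (λ j → Σ[ (λ k → A i k * B k j) ] * v j) ]     ≈⟨ Σ-cong (λ j → trans (*-comm _ (v j)) (sym (Σ-*ˡ (v j) (λ k → A i k * B k j)))) ⟩
    Σ[ (λ j → Σ[ (λ k → v j * (A i k * B k j)) ]) ]   ≈⟨ Σ-comm (λ j k → v j * (A i k * B k j)) ⟩
    Σ[ (λ k → Σ[ (λ j → v j * (A i k * B k j)) ]) ]   ≈⟨ Σ-cong (λ k → trans (Σ-cong λ j → solve 3 (λ v a b → v :* (a :* b) := a :* (b :* v)) refl (v j) (A i k) (B k j))
                                                            (Σ-*ˡ (A i k) (λ j → B k j * v j))) ⟩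
    Σ[ (λ k → A i k * Σ[ (λ j → B k j * v j) ]) ]     ∎

  ⊛-cong : ∀ {m} {A B : Mat m} {u v : Vector m} → (∀ i j → A i j ≈ B i j) → (∀ i → u i ≈ v i) → ∀ i → (A ⊛ u) i ≈ (B ⊛ v) i
  ⊛-cong e e' i = dot-cong (e i) e'

  I-· : ∀ {m} (A : Mat m) i j → (I · A) i j ≈ A i j
  I-· A i j = trans (dot-cong {v = λ k → A k j} (I≈δ i) (λ _ → refl)) (dot-δ i (λ k → A k j))

  ·-I : ∀ {m} (A : Mat m) i j → (A · I) i j ≈ A i j
  ·-I A i j = trans (dot-cong {u = A i} (λ _ → refl) (λ k → trans (I≈δ k j) (reflexive (δ-sym k j)))) (trans (dot-comm (A i) (δ j)) (dot-δ j (A i)))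

  ^-sucʳ : ∀ {m} (A : Mat m) k i j → (A ^ᴹ suc k) i j ≈ ((A ^ᴹ k) · A) i j
  ^-sucʳ A zero    i j = trans (·-I A i j) (sym (I-· A i j))
  ^-sucʳ A (suc k) i j = begin
    dot (A i) (λ l → (A ^ᴹ suc k) l j)           ≈⟨ dot-cong {u = A i} (λ _ → refl) (λ l → ^-sucʳ A k l j) ⟩
    (A ⊛ ((A ^ᴹ k) ⊛ (λ l → A l j))) i           ≈⟨ ·-⊛ A (A ^ᴹ k) (λ l → A l j) i ⟨
    ((A ^ᴹ suc k) · A) i j                       ∎

  ^-⊛-sucʳ : ∀ {m} (A : Mat m) k v i → ((A ^ᴹ suc k) ⊛ v) i ≈ ((A ^ᴹ k) ⊛ (A ⊛ v)) i
  ^-⊛-sucʳ A k v i = trans (⊛-cong {v = v} (^-sucʳ A k) (λ _ → refl) i) (·-⊛ (A ^ᴹ k) A v i)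

  module Entries {n} (τ : Mat (suc n)) where
    open Resolvent τ using (last; inject₁≢last; A; col; row)

    R S : ℕ → Vector n
    R i k = (τ ^ᴹ suc i) last (inject₁ k)
    S i k = (τ ^ᴹ suc i) (inject₁ k) last

    corner : ℕ → Carrier
    corner i = (τ ^ᴹ suc i) last last

    R-zero : ∀ k → R 0 k ≈ row k
    R-zero k = ·-I τ last (inject₁ k)

    R-suc : ∀ i k → R (suc i) k ≈ ((A ᵀ) ⊛ R i) k + corner i * row k
    R-suc i k = begin
      (τ ^ᴹ suc (suc i)) last (inject₁ k)                            ≈⟨ ^-sucʳ τ (suc i) last (inject₁ k) ⟩
      dot ((τ ^ᴹ suc i) last) (λ l → τ l (inject₁ k))                ≈⟨ Σ-last (λ l → (τ ^ᴹ suc i) last l * τ l (inject₁ k)) ⟩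
      dot (R i) (λ l → A l k) + corner i * row k                     ≈⟨ +-congʳ (dot-comm (R i) (λ l → A l k)) ⟩
      ((A ᵀ) ⊛ R i) k + corner i * row k                             ∎

    S-zero : ∀ k → S 0 k ≈ col k
    S-zero k = ·-I τ (inject₁ k) last

    S-suc : ∀ i k → S (suc i) k ≈ (A ⊛ S i) k + corner i * col k
    S-suc i k = trans (Σ-last (λ l → τ (inject₁ k) l * (τ ^ᴹ suc i) l last)) (+-congˡ (*-comm _ _))

    -- Last rows and last columns of the powers of τ obey recursions with the same scalars
    -- `corner i`. The exponent j is left general because moving A across the pairing raises it.
    -- This symmetry makes the two contributions to an entry of D equal and so is the origin of the
    -- factor 2.
    R-S-symmetric : ∀ i j → dot (R i) ((A ^ᴹ j) ⊛ col) ≈ dot row ((A ^ᴹ j) ⊛ S i)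
    R-S-symmetric zero j = dot-cong R-zero (⊛-cong {A = A ^ᴹ j} (λ _ _ → refl) (sym ∘ S-zero))
    R-S-symmetric (suc i) j = begin
      dot (R (suc i)) (Aʲ ⊛ col)
        ≈⟨ dot-cong {v = Aʲ ⊛ col} (R-suc i) (λ _ → refl) ⟩
      dot (λ k → ((A ᵀ) ⊛ R i) k + corner i * row k) (Aʲ ⊛ col)
        ≈⟨ dot-linearˡ ((A ᵀ) ⊛ R i) (corner i) row (Aʲ ⊛ col) ⟩
      dot ((A ᵀ) ⊛ R i) (Aʲ ⊛ col) + corner i * dot row (Aʲ ⊛ col)
        ≈⟨ +-congʳ (trans (dot-adjoint A (R i) (Aʲ ⊛ col)) (dot-cong {u = R i} (λ _ → refl) (λ k → sym (·-⊛ A Aʲ col k)))) ⟩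
      dot (R i) ((A ^ᴹ suc j) ⊛ col) + corner i * dot row (Aʲ ⊛ col)
        ≈⟨ +-congʳ (R-S-symmetric i (suc j)) ⟩
      dot row ((A ^ᴹ suc j) ⊛ S i) + corner i * dot row (Aʲ ⊛ col)
        ≈⟨ +-congʳ (dot-cong {u = row} (λ _ → refl) (^-⊛-sucʳ A j (S i))) ⟩
      dot row (Aʲ ⊛ (A ⊛ S i)) + corner i * dot row (Aʲ ⊛ col)
        ≈⟨ dot-linearʳ row (Aʲ ⊛ (A ⊛ S i)) (corner i) (Aʲ ⊛ col) ⟨
      dot row (λ k → (Aʲ ⊛ (A ⊛ S i)) k + corner i * (Aʲ ⊛ col) k)
        ≈⟨ dot-cong {u = row} (λ _ → refl) (λ k → trans (dot-cong {u = Aʲ k} (λ _ → refl) (S-suc i)) (dot-linearʳ (Aʲ k) (A ⊛ S i) (corner i) col)) ⟨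
      dot row (Aʲ ⊛ S (suc i)) ∎
      where
      Aʲ = A ^ᴹ j

    toℕ-inject₁≢n : ∀ (i : Fin n) → toℕ (inject₁ i) ≢ n
    toℕ-inject₁≢n i e = ℕₚ.<-irrefl (≡.trans (≡.sym (Finₚ.toℕ-inject₁ i)) e) (Finₚ.toℕ<n i)

    1H-upper : ∀ (i j : Fin (suc n)) → toℕ i ≢ n → 1H i j ≈ δ i j
    1H-upper i j ≢n with i Finₚ.≟ j | toℕ i ℕ.≟ n
    ... | yes _      | yes e = contradiction e ≢n
    ... | no _       | yes e = contradiction e ≢n
    ... | yes i≡j    | no _  = reflexive (≡.sym (≡.trans (cong (δ i) (≡.sym i≡j)) (δ-diagonal i)))
    ... | no i≢j     | no _  = reflexive (≡.sym (δ-off i j i≢j))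

    1H-lower : ∀ (i j : Fin (suc n)) → toℕ i ≡ n → 1H i j ≈ 0#
    1H-lower i j e with i Finₚ.≟ j | toℕ i ℕ.≟ n
    ... | _     | no ≢n = contradiction e ≢n
    ... | yes _ | yes _ = refl
    ... | no _  | yes _ = refl

    1H-inject₁ʳ : ∀ (i : Fin (suc n)) j → 1H i (inject₁ j) ≈ δ (inject₁ j) i
    1H-inject₁ʳ i j = by-cases (toℕ i ℕ.≟ n)
      where
      by-cases : Dec (toℕ i ≡ n) → 1H i (inject₁ j) ≈ δ (inject₁ j) i
      by-cases (yes e) = trans (1H-lower i (inject₁ j) e)
        (reflexive (≡.sym (δ-off (inject₁ j) i λ j≡i → toℕ-inject₁≢n j (≡.trans (cong toℕ j≡i) e))))
      by-cases (no ≢n) = trans (1H-upper i (inject₁ j) ≢n) (reflexive (δ-sym i (inject₁ j)))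

    1H-lastʳ : ∀ (i : Fin (suc n)) → 1H i last ≈ 0#
    1H-lastʳ i = by-cases (toℕ i ℕ.≟ n)
      where
      by-cases : Dec (toℕ i ≡ n) → 1H i last ≈ 0#
      by-cases (yes e) = 1H-lower i last e
      by-cases (no ≢n) = trans (1H-upper i last ≢n) (reflexive (δ-off i last λ i≡last → ≢n (≡.trans (cong toℕ i≡last) (Finₚ.toℕ-fromℕ n))))

    1H-·-inject₁ : ∀ (W : Mat (suc n)) i j → (1H · W) (inject₁ i) j ≈ W (inject₁ i) j
    1H-·-inject₁ W i j = trans (dot-cong {v = λ k → W k j} (λ k → 1H-upper (inject₁ i) k (toℕ-inject₁≢n i)) (λ _ → refl)) (dot-δ (inject₁ i) (λ k → W k j))

    1H-·-last : ∀ (W : Mat (suc n)) j → (1H · W) last j ≈ 0#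
    1H-·-last W j = dot-zeroˡ (1H last) (λ k → W k j) (λ k → 1H-lower last k (Finₚ.toℕ-fromℕ n))

    ·-1H-inject₁ : ∀ (W : Mat (suc n)) i j → (W · 1H) i (inject₁ j) ≈ W i (inject₁ j)
    ·-1H-inject₁ W i j = trans (dot-cong {u = W i} (λ _ → refl) (λ k → 1H-inject₁ʳ k j))
      (trans (dot-comm (W i) (δ (inject₁ j))) (dot-δ (inject₁ j) (W i)))

    ·-1H-last : ∀ (W : Mat (suc n)) i → (W · 1H) i last ≈ 0#
    ·-1H-last W i = dot-zeroʳ (W i) (λ k → 1H k last) 1H-lastʳ

    H-inject₁ : ∀ i j → (τ H) (inject₁ i) (inject₁ j) ≈ A i j
    H-inject₁ i j with toℕ (inject₁ i) ℕ.≟ n | toℕ (inject₁ j) ℕ.≟ n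
    ... | no _  | no _  = refl
    ... | yes e | _     = contradiction e (toℕ-inject₁≢n i)
    ... | no _  | yes e = contradiction e (toℕ-inject₁≢n j)

    H-last : ∀ i → (τ H) (inject₁ i) last ≈ 0#
    H-last i with toℕ (inject₁ i) ℕ.≟ n | toℕ last ℕ.≟ n
    ... | _     | no ≢  = contradiction (Finₚ.toℕ-fromℕ n) ≢
    ... | yes _ | yes _ = refl
    ... | no _  | yes _ = refl

    H-·-inject₁ : ∀ (W : Mat (suc n)) i j → ((τ H) · W) (inject₁ i) j ≈ dot (A i) (λ k → W (inject₁ k) j)
    H-·-inject₁ W i j = begin
      dot ((τ H) (inject₁ i)) (λ k → W k j)
        ≈⟨ Σ-last (λ k → (τ H) (inject₁ i) k * W k j) ⟩
      dot (λ k → (τ H) (inject₁ i) (inject₁ k)) (λ k → W (inject₁ k) j) + (τ H) (inject₁ i) last * W last j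
        ≈⟨ +-cong (dot-cong {v = λ k → W (inject₁ k) j} (H-inject₁ i) (λ _ → refl)) (trans (*-congʳ (H-last i)) (zeroˡ _)) ⟩
      dot (A i) (λ k → W (inject₁ k) j) + 0#
        ≈⟨ +-identityʳ _ ⟩
      dot (A i) (λ k → W (inject₁ k) j) ∎

    H^-inject₁ : ∀ k i j → ((τ H) ^ᴹ k) (inject₁ i) (inject₁ j) ≈ (A ^ᴹ k) i j
    H^-inject₁ zero    i j = trans (I≈δ (inject₁ i) (inject₁ j)) (trans (reflexive (δ-inject₁ i j)) (sym (I≈δ i j)))
    H^-inject₁ (suc k) i j = trans (H-·-inject₁ ((τ H) ^ᴹ k) i (inject₁ j)) (dot-cong {u = A i} (λ _ → refl) (λ l → H^-inject₁ k l j))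

    H^-last : ∀ k i → ((τ H) ^ᴹ k) (inject₁ i) last ≈ 0#
    H^-last zero    i = trans (I≈δ (inject₁ i) last) (reflexive (δ-off (inject₁ i) last (inject₁≢last i)))
    H^-last (suc k) i = trans (H-·-inject₁ ((τ H) ^ᴹ k) i last) (dot-zeroʳ (A i) (λ l → ((τ H) ^ᴹ k) (inject₁ l) last) (H^-last k))

    Hpow-inject₁ : ∀ j i k → Hpow τ j (inject₁ i) (inject₁ k) ≈ (A ^ᴹ j) i k
    Hpow-inject₁ j i k = trans (1H-·-inject₁ ((τ H) ^ᴹ j) i (inject₁ k)) (H^-inject₁ j i k)

    -- At j = 0 the matrix power is the identity, whose corner is 1; the factor `1H` removes it.
    Hpow-lastʳ : ∀ j i → Hpow τ j i last ≈ 0#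
    Hpow-lastʳ j i with view i
    ... | ‵fromℕ     = 1H-·-last ((τ H) ^ᴹ j) last
    ... | ‵inject₁ k = trans (1H-·-inject₁ ((τ H) ^ᴹ j) k last) (H^-last j k)

    Hpow-lastˡ : ∀ j k → Hpow τ j last k ≈ 0#
    Hpow-lastˡ j k = 1H-·-last ((τ H) ^ᴹ j) k

    module _ (i j : ℕ) where
      private
        X Y W V : Mat (suc n)
        X = τ ^ᴹ suc i
        Y = Hpow τ j
        W = [ X , Y ]
        V = [ 1H , W ]
        Aʲ = A ^ᴹ j

      W-last-column : ∀ k → W (inject₁ k) last ≈ - (Aʲ ⊛ S i) k
      W-last-column k = begin
        (X · Y) (inject₁ k) last - (Y · X) (inject₁ k) last
          ≈⟨ +-cong (dot-zeroʳ (X (inject₁ k)) (λ l → Y l last) (Hpow-lastʳ j))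
               (-‿cong (trans (Σ-last (λ l → Y (inject₁ k) l * X l last))
                 (+-cong (dot-cong {v = S i} (Hpow-inject₁ j k) (λ _ → refl)) (trans (*-congʳ (Hpow-lastʳ j (inject₁ k))) (zeroˡ _))))) ⟩
        0# - ((Aʲ ⊛ S i) k + 0#)
          ≈⟨ solve 1 (λ x → con (0 , 0) :- (x :+ con (0 , 0)) := :- x) refl ((Aʲ ⊛ S i) k) ⟩
        - (Aʲ ⊛ S i) k ∎

      W-last-row : ∀ k → W last (inject₁ k) ≈ ((Aʲ ᵀ) ⊛ R i) k
      W-last-row k = begin
        (X · Y) last (inject₁ k) - (Y · X) last (inject₁ k)
          ≈⟨ +-cong (trans (Σ-last (λ l → X last l * Y l (inject₁ k)))
                 (+-cong (trans (dot-cong {u = R i} (λ _ → refl) (λ l → Hpow-inject₁ j l k)) (dot-comm (R i) (λ l → Aʲ l k)))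
                   (trans (*-congˡ (Hpow-lastˡ j (inject₁ k))) (zeroʳ _))))
               (-‿cong (dot-zeroˡ (Y last) (λ l → X l (inject₁ k)) (Hpow-lastˡ j))) ⟩
        ((Aʲ ᵀ) ⊛ R i) k + 0# - 0#
          ≈⟨ solve 1 (λ x → x :+ con (0 , 0) :- con (0 , 0) := x) refl (((Aʲ ᵀ) ⊛ R i) k) ⟩
        ((Aʲ ᵀ) ⊛ R i) k ∎

      -- The commutator with the projection `1H` kills the diagonal blocks and keeps the
      -- off-diagonal ones with opposite signs. So only the last column and the last row of W enter
      -- the trace, through `row` and `col`.
      V-block : ∀ k l → V (inject₁ k) (inject₁ l) ≈ 0#
      V-block k l = trans (+-cong (1H-·-inject₁ W k (inject₁ l)) (-‿cong (·-1H-inject₁ W (inject₁ k) l))) (-‿inverseʳ _)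

      V-last-column : ∀ k → V (inject₁ k) last ≈ W (inject₁ k) last
      V-last-column k = trans (+-cong (1H-·-inject₁ W k last) (-‿cong (·-1H-last W (inject₁ k)))) (solve 1 (λ x → x :- con (0 , 0) := x) refl (W (inject₁ k) last))

      V-last-row : ∀ k → V last (inject₁ k) ≈ - W last (inject₁ k)
      V-last-row k = trans (+-cong (1H-·-last W (inject₁ k)) (-‿cong (·-1H-inject₁ W last k))) (+-identityˡ _)

      V-corner : V last last ≈ 0#
      V-corner = trans (+-cong (1H-·-last W last) (-‿cong (·-1H-last W last))) (-‿inverseʳ 0#)

      entry : ⟨ V , τ ⟩ ≈ - ⟦ 2 ⟧ * dot (R i) (Aʲ ⊛ col)
      entry = begin
        Σ[ (λ k → (V · τ) k k) ]
          ≈⟨ Σ-last (λ k → (V · τ) k k) ⟩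
        Σ[ (λ k → (V · τ) (inject₁ k) (inject₁ k)) ] + (V · τ) last last
          ≈⟨ +-cong (Σ-cong λ k → upper k) lower ⟩
        Σ[ (λ k → - 1# * (row k * (Aʲ ⊛ S i) k)) ] + - 1# * dot ((Aʲ ᵀ) ⊛ R i) col
          ≈⟨ +-cong (Σ-*ˡ (- 1#) (λ k → row k * (Aʲ ⊛ S i) k)) (*-congˡ (dot-adjoint Aʲ (R i) col)) ⟩
        - 1# * dot row (Aʲ ⊛ S i) + - 1# * dot (R i) (Aʲ ⊛ col)
          ≈⟨ +-congʳ (*-congˡ (R-S-symmetric i j)) ⟨
        - 1# * dot (R i) (Aʲ ⊛ col) + - 1# * dot (R i) (Aʲ ⊛ col)
          ≈⟨ solve 1 (λ x → (:- con (1 , 0)) :* x :+ (:- con (1 , 0)) :* x := (:- (con (1 , 0) :+ (con (1 , 0) :+ con (0 , 0)))) :* x) refl (dot (R i) (Aʲ ⊛ col)) ⟩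
        - ⟦ 2 ⟧ * dot (R i) (Aʲ ⊛ col) ∎
        where
        upper : ∀ k → (V · τ) (inject₁ k) (inject₁ k) ≈ - 1# * (row k * (Aʲ ⊛ S i) k)
        upper k = begin
          dot (V (inject₁ k)) (λ l → τ l (inject₁ k))
            ≈⟨ Σ-last (λ l → V (inject₁ k) l * τ l (inject₁ k)) ⟩
          dot (λ l → V (inject₁ k) (inject₁ l)) (λ l → A l k) + V (inject₁ k) last * row k
            ≈⟨ +-cong (dot-zeroˡ (λ l → V (inject₁ k) (inject₁ l)) (λ l → A l k) (V-block k)) (*-congʳ (trans (V-last-column k) (W-last-column k))) ⟩
          0# + - (Aʲ ⊛ S i) k * row k
            ≈⟨ solve 2 (λ x y → con (0 , 0) :+ (:- x) :* y := (:- con (1 , 0)) :* (y :* x)) refl ((Aʲ ⊛ S i) k) (row k) ⟩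
          - 1# * (row k * (Aʲ ⊛ S i) k) ∎
        lower : (V · τ) last last ≈ - 1# * dot ((Aʲ ᵀ) ⊛ R i) col
        lower = begin
          dot (V last) (λ l → τ l last)
            ≈⟨ Σ-last (λ l → V last l * τ l last) ⟩
          dot (λ l → V last (inject₁ l)) col + V last last * τ last last
            ≈⟨ +-cong (Σ-cong λ l → trans (*-congʳ (trans (V-last-row l) (-‿cong (W-last-row l))))
                 (solve 2 (λ x y → (:- x) :* y := (:- con (1 , 0)) :* (x :* y)) refl (((Aʲ ᵀ) ⊛ R i) l) (col l))) (trans (*-congʳ V-corner) (zeroˡ _)) ⟩
          Σ[ (λ l → - 1# * (((Aʲ ᵀ) ⊛ R i) l * col l)) ] + 0#
            ≈⟨ trans (+-identityʳ _) (Σ-*ˡ (- 1#) (λ l → ((Aʲ ᵀ) ⊛ R i) l * col l)) ⟩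
          - 1# * dot ((Aʲ ᵀ) ⊛ R i) col ∎

  -- Spans and Krylov vectors

  module _ {m} {β : ℕ → Vector m} where

    InSpan-cong : ∀ {k u v} → (∀ i → u i ≈ v i) → InSpan β k u → InSpan β k v
    InSpan-cong e (null z)       = null λ i → trans (sym (e i)) (z i)
    InSpan-cong e (extend t w h) = extend t w λ i → trans (sym (e i)) (h i)

    InSpan-linear : ∀ {k u v} t → InSpan β k u → InSpan β k v → InSpan β k (λ i → u i + t * v i)
    InSpan-linear t (null z) (null z') = null λ i → trans (+-cong (z i) (*-congˡ (z' i))) (trans (+-identityˡ _) (zeroʳ t))
    InSpan-linear {suc k} t (extend {w = u} a u∈ e) (extend {w = v} b v∈ e') = extend (a + t * b) (InSpan-linear t u∈ v∈) λ i →
      trans (+-cong (e i) (*-congˡ (e' i)))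
        (solve 6 (λ u a β t v b → u :+ a :* β :+ t :* (v :+ b :* β) := u :+ t :* v :+ (a :+ t :* b) :* β) refl (u i) a (β k i) t (v i) b)

    InSpan-weaken : ∀ {k v} → InSpan β k v → InSpan β (suc k) v
    InSpan-weaken v∈ = extend 0# v∈ λ i → sym (trans (+-congˡ (zeroˡ _)) (+-identityʳ _))

    InSpan-zero : ∀ k → InSpan β k (λ _ → 0#)
    InSpan-zero zero    = null λ _ → refl
    InSpan-zero (suc k) = InSpan-weaken (InSpan-zero k)

    InSpan-last : ∀ k → InSpan β (suc k) (β k)
    InSpan-last k = extend 1# (InSpan-zero k) λ i → sym (trans (+-identityˡ _) (*-identityˡ _))

    InSpan-first : ∀ k → InSpan β (suc k) (β 0)
    InSpan-first zero    = InSpan-last 0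
    InSpan-first (suc k) = InSpan-weaken (InSpan-first k)

    InSpan-dot : ∀ {l k v} (ρ : Fin l → Vector m) → InSpan β k v → InSpan (λ j i → dot (ρ i) (β j)) k (λ i → dot (ρ i) v)
    InSpan-dot ρ (null z)                     = null λ i → dot-zeroʳ (ρ i) _ z
    InSpan-dot {k = suc k} ρ (extend {w = w} t w∈ e) = extend t (InSpan-dot ρ w∈) λ i →
      trans (dot-cong {u = ρ i} (λ _ → refl) e) (dot-linearʳ (ρ i) w t (β k))

  module _ {m} (A : Mat m) (μ : ℕ → Carrier) (v : Vector m) where
    private
      s : ℕ → Vector m
      s = newton A μ v

    -- Rests on A s k = s (k + 1) + μ k s k, the defining step of the Newton vectors read backwards.
    InSpan-⊛ : ∀ {k u} → InSpan s k u → InSpan s (suc k) (A ⊛ u)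
    InSpan-⊛ {u = u} (null z) = InSpan-weaken (null λ i → dot-zeroʳ (A i) u z)
    InSpan-⊛ {suc k} {u} (extend {w = w} t w∈ e) = InSpan-cong regroup
      (InSpan-linear t (InSpan-linear (t * μ k) (InSpan-weaken (InSpan-⊛ w∈)) (InSpan-weaken (InSpan-last k))) (InSpan-last (suc k)))
      where
      regroup : ∀ i → (A ⊛ w) i + t * μ k * s k i + t * ((A ⊛ s k) i - μ k * s k i) ≈ (A ⊛ u) i
      regroup i = begin
        (A ⊛ w) i + t * μ k * s k i + t * ((A ⊛ s k) i - μ k * s k i)
          ≈⟨ solve 5 (λ a t m s b → a :+ t :* m :* s :+ t :* (b :- m :* s) := a :+ t :* b) refl ((A ⊛ w) i) t (μ k) (s k i) ((A ⊛ s k) i) ⟩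
        (A ⊛ w) i + t * (A ⊛ s k) i
          ≈⟨ dot-linearʳ (A i) w t (s k) ⟨
        dot (A i) (λ i → w i + t * s k i)
          ≈⟨ dot-cong {u = A i} (λ _ → refl) e ⟨
        (A ⊛ u) i ∎

    -- The multiple of v = s 0 that each step may add stays within the span. This lets one statement
    -- cover both sides: with p = 0 for the vectors Aʲ col, and with p = `corner` for the last rows
    -- of the powers of τ.
    krylov-newton : ∀ (r : ℕ → Vector m) (p : ℕ → Carrier) → (∀ i → r 0 i ≈ v i) →
                    (∀ k i → r (suc k) i ≈ (A ⊛ r k) i + p k * v i) →
                    ∀ k → InSpan s k (λ i → r k i - s k i)
    krylov-newton r p r0 r+ zero = null λ i → trans (+-congʳ (r0 i)) (-‿inverseʳ (v i))
    krylov-newton r p r0 r+ (suc k) = InSpan-cong regroup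
      (InSpan-linear (p k) (InSpan-linear (μ k) (InSpan-⊛ (krylov-newton r p r0 r+ k)) (InSpan-last k)) (InSpan-first k))
      where
      regroup : ∀ i → (A ⊛ (λ i → r k i - s k i)) i + μ k * s k i + p k * v i ≈ r (suc k) i - s (suc k) i
      regroup i = begin
        (A ⊛ (λ i → r k i - s k i)) i + μ k * s k i + p k * v i
          ≈⟨ +-congʳ (+-congʳ (trans (dot-cong {u = A i} (λ _ → refl) (λ j → solve 2 (λ r s → r :- s := r :+ (:- con (1 , 0)) :* s) refl (r k j) (s k j)))
               (dot-linearʳ (A i) (r k) (- 1#) (s k)))) ⟩
        (A ⊛ r k) i + - 1# * (A ⊛ s k) i + μ k * s k i + p k * v i
          ≈⟨ solve 4 (λ r s m p → r :+ (:- con (1 , 0)) :* s :+ m :+ p := r :+ p :- (s :- m)) refl ((A ⊛ r k) i) ((A ⊛ s k) i) (μ k * s k i) (p k * v i) ⟩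
        (A ⊛ r k) i + p k * v i - s (suc k) i
          ≈⟨ +-congʳ (r+ k i) ⟨
        r (suc k) i - s (suc k) i ∎

  det-dot-columns : ∀ {n} (ρ : Fin n → Vector n) (β γ : ℕ → Vector n) → (∀ k → InSpan β k (λ i → γ k i - β k i)) →
                    det (λ i j → dot (ρ i) (γ (toℕ j))) ≈ det (λ i j → dot (ρ i) (β (toℕ j)))
  det-dot-columns ρ β γ γ-β = det-unitriangular (λ k i → dot (ρ i) (β k)) (λ k i → dot (ρ i) (γ k)) λ k →
    InSpan-cong (λ i → begin
      dot (ρ i) (λ l → γ k l - β k l)           ≈⟨ dot-cong {u = ρ i} (λ _ → refl) (λ l → solve 2 (λ r s → r :- s := r :+ (:- con (1 , 0)) :* s) refl (γ k l) (β k l)) ⟩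
      dot (ρ i) (λ l → γ k l + - 1# * β k l)    ≈⟨ dot-linearʳ (ρ i) (γ k) (- 1#) (β k) ⟩
      dot (ρ i) (γ k) + - 1# * dot (ρ i) (β k)  ≈⟨ solve 2 (λ r s → r :+ (:- con (1 , 0)) :* s := r :- s) refl (dot (ρ i) (γ k)) (dot (ρ i) (β k)) ⟩
      dot (ρ i) (γ k) - dot (ρ i) (β k)         ∎) (InSpan-dot ρ (γ-β k))

  det-dot-rows : ∀ {n} (ρ : Fin n → Vector n) (β γ : ℕ → Vector n) → (∀ k → InSpan β k (λ i → γ k i - β k i)) →
                 det (λ i j → dot (γ (toℕ i)) (ρ j)) ≈ det (λ i j → dot (β (toℕ i)) (ρ j))
  det-dot-rows ρ β γ γ-β = begin
    det (λ i j → dot (γ (toℕ i)) (ρ j))   ≈⟨ det-ᵀ (λ i j → dot (γ (toℕ i)) (ρ j)) ⟩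
    det (λ i j → dot (γ (toℕ j)) (ρ i))   ≈⟨ det-cong (λ i j → dot-comm (γ (toℕ j)) (ρ i)) ⟩
    det (λ i j → dot (ρ i) (γ (toℕ j)))   ≈⟨ det-dot-columns ρ β γ γ-β ⟩
    det (λ i j → dot (ρ i) (β (toℕ j)))   ≈⟨ det-cong (λ i j → dot-comm (ρ i) (β (toℕ j))) ⟩
    det (λ i j → dot (β (toℕ j)) (ρ i))   ≈⟨ det-ᵀ (λ i j → dot (β (toℕ i)) (ρ j)) ⟨
    det (λ i j → dot (β (toℕ i)) (ρ j))   ∎

  -- Signs and the comparison of the two products

  -- Roots indexed by ℕ let `newton` and `reversed` run without bounds. The default 0 is arbitrary:
  -- the characteristic polynomial involves only the indices below n.
  extendByZero : ∀ {n} → (Fin n → Carrier) → ℕ → Carrier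
  extendByZero {zero}  f k       = 0#
  extendByZero {suc n} f zero    = f zero
  extendByZero {suc n} f (suc k) = extendByZero (f ∘ suc) k

  extendByZero-toℕ : ∀ {n} (f : Fin n → Carrier) i → extendByZero f (toℕ i) ≡ f i
  extendByZero-toℕ f zero    = ≡.refl
  extendByZero-toℕ f (suc i) = extendByZero-toℕ (f ∘ suc) i

  Π-neg : ∀ {k} (f : Fin k → Carrier) → Π[ (λ i → - f i) ] ≈ sgn k * Π[ f ]
  Π-neg {zero}  f = sym (*-identityˡ 1#)
  Π-neg {suc k} f = trans (*-congˡ (Π-neg (f ∘ suc)))
    (solve 3 (λ x s p → (:- x) :* (s :* p) := (:- s) :* (x :* p)) refl (f zero) (sgn k) Π[ f ∘ suc ])

  Π-const : ∀ k t → Π[ (λ (_ : Fin k) → t) ] ≈ t ^ k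
  Π-const zero    t = refl
  Π-const (suc k) t = *-congˡ (Π-const k t)

  -‿^ : ∀ k t → (- t) ^ k ≈ sgn k * t ^ k
  -‿^ k t = trans (sym (Π-const k (- t))) (trans (Π-neg (λ (_ : Fin k) → t)) (*-congˡ (Π-const k t)))

  sgn-±1 : ∀ k → sgn k ≈ 1# ⊎ sgn k ≈ - 1#
  sgn-±1 zero = inj₁ refl
  sgn-±1 (suc k) with sgn-±1 k
  ... | inj₁ e = inj₂ (-‿cong e)
  ... | inj₂ e = inj₁ (trans (-‿cong e) (-‿involutive 1#))

  1^ : ∀ k → 1# ^ k ≈ 1#
  1^ zero    = refl
  1^ (suc k) = trans (*-identityˡ _) (1^ k)

  ^-cong : ∀ k {x y} → x ≈ y → x ^ k ≈ y ^ k
  ^-cong zero    e = refl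
  ^-cong (suc k) e = *-cong e (^-cong k e)

  -- n² and n have the same parity.
  sgn-^ : ∀ k → sgn k ^ k ≈ sgn k
  sgn-^ k with sgn-±1 k
  ... | inj₁ e = trans (^-cong k e) (trans (1^ k) (sym e))
  ... | inj₂ e = trans (^-cong k e) (trans (-‿^ k 1#) (trans (*-congˡ (1^ k)) (*-identityʳ _)))

  module _ {n} (τ : Mat (suc n)) (λs : Fin (suc n) → Carrier) (μs : Fin n → Carrier)
           (τ-eigenvalues : IsEigenvalueList τ λs) (block-eigenvalues : IsEigenvalueList (block τ) μs) where
    open Resolvent τ
    open Entries τ using (R; R-zero; R-suc; corner; entry)

    private
      μ : ℕ → Carrier
      μ = extendByZero μs

      charpoly : ∀ x → det (scal x ⊖ A) ≈ rootProduct μ n x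
      charpoly x = trans (block-eigenvalues x) (Π-cong λ i → reflexive (cong (λ y → x - y) (≡.sym (extendByZero-toℕ μs i))))

      z y : ℕ → Vector n
      z j = (A ^ᴹ j) ⊛ col
      y = newton A (reversed μ) col

      g : Fin n → Carrier
      g i = dot (newtonQuotient (A ᵀ) μ row n (μ (toℕ i))) col

    Δ≈ : Δ τ ≈ (- ⟦ 2 ⟧) ^ n * (sgn ((n ℕ.* (n ℕ.∸ 1)) / 2) * Π[ g ])
    Δ≈ = begin
      det (Dmat τ)
        ≈⟨ det-cong {n} {Dmat τ} (λ i j → entry (toℕ i) (toℕ j)) ⟩
      det {n} (λ i j → - ⟦ 2 ⟧ * dot (R (toℕ i)) (z (toℕ j)))
        ≈⟨ det-scale {n} (- ⟦ 2 ⟧) (λ i j → dot (R (toℕ i)) (z (toℕ j))) ⟩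
      (- ⟦ 2 ⟧) ^ n * det {n} (λ i j → dot (R (toℕ i)) (z (toℕ j)))
        ≈⟨ *-congˡ (det-dot-columns (R ∘ toℕ) y z (krylov-newton A (reversed μ) col z (λ _ → 0#) z-zero z-suc)) ⟩
      (- ⟦ 2 ⟧) ^ n * det {n} (λ i j → dot (R (toℕ i)) (y (toℕ j)))
        ≈⟨ *-congˡ (det-dot-rows (y ∘ toℕ) (newton (A ᵀ) μ row) R (krylov-newton (A ᵀ) μ row R corner R-zero R-suc)) ⟩
      (- ⟦ 2 ⟧) ^ n * det {n} (λ i j → pairing μ (toℕ i) (toℕ j))
        ≈⟨ *-congˡ (det-pairing μ charpoly) ⟩
      (- ⟦ 2 ⟧) ^ n * (sgn ((n ℕ.* (n ℕ.∸ 1)) / 2) * Π[ g ]) ∎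
      where
      z-zero : ∀ i → z 0 i ≈ col i
      z-zero i = trans (dot-cong {v = col} (I≈δ i) (λ _ → refl)) (dot-δ i col)
      z-suc : ∀ k i → z (suc k) i ≈ (A ⊛ z k) i + 0# * col i
      z-suc k i = trans (·-⊛ A (A ^ᴹ k) col i) (sym (trans (+-congˡ (zeroˡ _)) (+-identityʳ _)))

    -- For fixed j, the n + 1 changes of sign from λᵢ - μⱼ to μⱼ - λᵢ and the minus sign of
    -- `det-at-root` combine to (-1)^n. The product over j raises this to the n-th power, which
    -- `sgn-^` undoes.
    Δ₀≈ : Δ₀ λs μs ≈ sgn n * Π[ g ]
    Δ₀≈ = begin
      Π[ (λ i → Π[ (λ j → λs i - μs j) ]) ]   ≈⟨ Π-comm (λ i j → λs i - μs j) ⟩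
      Π[ (λ j → Π[ (λ i → λs i - μs j) ]) ]   ≈⟨ Π-cong factor ⟩
      Π[ (λ j → sgn n * g j) ]                ≈⟨ Π-* (λ _ → sgn n) g ⟩
      Π[ (λ (_ : Fin n) → sgn n) ] * Π[ g ]   ≈⟨ *-congʳ (trans (Π-const n (sgn n)) (sgn-^ n)) ⟩
      sgn n * Π[ g ]                          ∎
      where
      factor : ∀ j → Π[ (λ i → λs i - μs j) ] ≈ sgn n * g j
      factor j = begin
        Π[ (λ i → λs i - μs j) ]
          ≈⟨ Π-cong {f = λ i → λs i - μs j} {g = λ i → - (μs j - λs i)} (λ i → solve 2 (λ l m → l :- m := :- (m :- l)) refl (λs i) (μs j)) ⟩
        Π[ (λ i → - (μs j - λs i)) ]
          ≈⟨ Π-neg (λ i → μs j - λs i) ⟩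
        - sgn n * Π[ (λ i → μs j - λs i) ]
          ≈⟨ *-congˡ (τ-eigenvalues (μs j)) ⟨
        - sgn n * det (scal (μs j) ⊖ τ)
          ≡⟨ cong (λ x → - sgn n * det (scal x ⊖ τ)) (extendByZero-toℕ μs j) ⟨
        - sgn n * det (scal (μ (toℕ j)) ⊖ τ)
          ≈⟨ *-congˡ (det-at-root μ charpoly (Finₚ.toℕ<n j)) ⟩
        - sgn n * - g j
          ≈⟨ solve 2 (λ s g → (:- s) :* (:- g) := s :* g) refl (sgn n) (g j) ⟩
        sgn n * g j ∎

    Δ≈const*Δ₀ : Δ τ ≈ const {n} * Δ₀ λs μs
    Δ≈const*Δ₀ = begin
      Δ τ
        ≈⟨ Δ≈ ⟩
      (- ⟦ 2 ⟧) ^ n * (σ * Π[ g ])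
        ≈⟨ *-congʳ (-‿^ n ⟦ 2 ⟧) ⟩
      -- The sign split off from (-2)^n is the one that turns the product of the gᵢ into `Δ₀`.
      sgn n * ⟦ 2 ⟧ ^ n * (σ * Π[ g ])
        ≈⟨ solve 4 (λ s t u p → s :* t :* (u :* p) := t :* u :* (s :* p)) refl (sgn n) (⟦ 2 ⟧ ^ n) σ Π[ g ] ⟩
      ⟦ 2 ⟧ ^ n * σ * (sgn n * Π[ g ])
        ≈⟨ *-congˡ Δ₀≈ ⟨
      const {n} * Δ₀ λs μs ∎
      where
      σ = sgn ((n ℕ.* (n ℕ.∸ 1)) / 2)

theorem19 : ∀ {c ℓ} (K : ACF₀ c ℓ) (n : ℕ) →
    let open ACF₀ K in let open Matrices K in
    (τ : Mat (suc n)) (λs : Fin (suc n) → Carrier) (μs : Fin n → Carrier) →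
    IsEigenvalueList τ λs → IsEigenvalueList (block τ) μs →
    Δ τ ≈ const {n} * Δ₀ λs μs
theorem19 K n = Δ≈const*Δ₀ K
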